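{- Let $I_n$ denote the number of unlabeled interval graphs on $n$ vertices. As $n\to\infty$, $$\log I_n \ \ge\ n\log n - 2n\log\log n - O(n);$$ that is, there exist a constant $C>0$ and an integer $N$ such that $\log I_n \ge n\log n - 2n\log\log n - Cn$ for all integers $n\ge N$.
   Context: A simple undirected graph is an interval graph if it is isomorphic to the intersection graph of a family of intervals on the real line: the vertices correspond to the intervals of the family, and two distinct vertices are adjacent if and only if the corresponding intervals have nonempty intersection. The number $I_n$ of unlabeled interval graphs on $n$ vertices is the number of isomorphism classes of interval graphs with exactly $n$ vertices. Here $\log$ is the natural logarithm. -}

module Defs where

open import Data.Nat as ℕ using (ℕ; zero; suc; _⊔_; _^_; z≤n; s≤s)
import Data.Nat.Properties as ℕ
open import Data.Integer as ℤ using (+_)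
import Data.Integer.Properties as ℤ
import Data.Integer.Solver as ℤSolver
open import Data.Rational as ℚ using (ℚ; 0ℚ; 1ℚ; ½; ∣_∣)
import Data.Rational.Properties as ℚ
import Data.Rational.Unnormalised as ℚᵘ
import Data.Rational.Unnormalised.Properties as ℚᵘ
open import Data.Rational.Solver using (module +-*-Solver)
open import Data.Fin as Fin using (Fin; zero; suc; toℕ; fromℕ<; combine; remQuot; finToFun; funToFin)
import Data.Fin.Properties as Fin
open import Data.Fin.Permutation as Perm using (Permutation′; _⟨$⟩ʳ_; _⟨$⟩ˡ_)
open import Data.Fin.Subset as Subset using (Subset)
import Data.Fin.Subset.Properties as Subset
open import Data.Product using (Σ; ∃; Σ-syntax; ∃-syntax; _×_; _,_; proj₁; proj₂; uncurry)
open import Data.Sum using (_⊎_; inj₁; inj₂)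
open import Data.Vec using (tabulate)
open import Data.Vec.Properties using (lookup⇒[]=; []=⇒lookup; lookup∘tabulate)
open import Function using (_∘_; _⇔_; mk⇔; Equivalence; Bijection)
open import Level using (0ℓ) renaming (suc to lsuc)
open import Relation.Binary using (Rel; Setoid; Symmetric; Irreflexive; Decidable)
open import Relation.Binary.PropositionalEquality as ≡
  using (_≡_; _≢_; refl; sym; trans; cong; cong₂; subst; subst₂)
open import Relation.Nullary
  using (¬_; Dec; yes; no; does; contradiction; ¬?; decidable-stable; ¬¬-excluded-middle; map′; _×-dec_; _→-dec_)
open import Relation.Nullary.Decidable using (dec-true)
open import Relation.Unary using (Pred; _∈_; _≬_; Satisfiable)

open +-*-Solver using (solve; _:=_; _:+_; _:*_; _:-_; :-_; con)

ι : ℕ → ℚ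
ι n = + n ℚ./ 1

ι-suc : ∀ n → ι (suc n) ≡ 1ℚ ℚ.+ ι n
ι-suc n = ℚ.toℚᵘ-injective (begin
  ℚ.toℚᵘ (ι (suc n))               ≈⟨ ℚ.toℚᵘ-fromℚᵘ _ ⟩
  ℚᵘ.mkℚᵘ (+ suc n) 0              ≈⟨ ℚᵘ.*≡* eq ⟩
  ℚᵘ.1ℚᵘ ℚᵘ.+ ℚᵘ.mkℚᵘ (+ n) 0      ≈⟨ ℚᵘ.+-congʳ ℚᵘ.1ℚᵘ (ℚᵘ.≃-sym (ℚ.toℚᵘ-fromℚᵘ (ℚᵘ.mkℚᵘ (+ n) 0))) ⟩
  ℚᵘ.1ℚᵘ ℚᵘ.+ ℚ.toℚᵘ (ι n)         ≈⟨ ℚᵘ.≃-sym (ℚ.toℚᵘ-homo-+ 1ℚ (ι n)) ⟩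
  ℚ.toℚᵘ (1ℚ ℚ.+ ι n)              ∎)
  where
  open import Relation.Binary.Reasoning.Setoid ℚᵘ.≃-setoid
  open ℤSolver.+-*-Solver renaming (solve to ℤsolve; con to ℤcon; _:+_ to _⊕_; _:*_ to _⊗_; _:=_ to _⊜_)
  eq : + suc n ℤ.* (+ 1) ≡ (+ 1 ℤ.* + 1 ℤ.+ + n ℤ.* + 1) ℤ.* + 1
  eq = ℤsolve 1 (λ n → (ℤcon (+ 1) ⊕ n) ⊗ ℤcon (+ 1) ⊜ (ℤcon (+ 1) ⊗ ℤcon (+ 1) ⊕ n ⊗ ℤcon (+ 1)) ⊗ ℤcon (+ 1)) refl (+ n)

0≤1 : 0ℚ ℚ.≤ 1ℚ
0≤1 = ℚ.nonNegative⁻¹ 1ℚ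

ι-+ : ∀ m n → ι (m ℕ.+ n) ≡ ι m ℚ.+ ι n
ι-+ zero    n = sym (ℚ.+-identityˡ (ι n))
ι-+ (suc m) n = trans (ι-suc (m ℕ.+ n)) (trans (cong (1ℚ ℚ.+_) (ι-+ m n))
  (trans (sym (ℚ.+-assoc 1ℚ (ι m) (ι n))) (cong (ℚ._+ ι n) (sym (ι-suc m)))))

ι-* : ∀ m n → ι (m ℕ.* n) ≡ ι m ℚ.* ι n
ι-* zero    n = sym (ℚ.*-zeroˡ (ι n))
ι-* (suc m) n = trans (ι-+ n (m ℕ.* n)) (trans (cong (ι n ℚ.+_) (ι-* m n))
  (trans (solve 2 (λ m n → n :+ m :* n := (con 1ℚ :+ m) :* n) refl (ι m) (ι n))
         (cong (ℚ._* ι n) (sym (ι-suc m)))))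

0≤ι : ∀ n → 0ℚ ℚ.≤ ι n
0≤ι zero    = ℚ.≤-refl
0≤ι (suc n) = subst (0ℚ ℚ.≤_) (sym (ι-suc n)) (ℚ.+-mono-≤ 0≤1 (0≤ι n))

0<ι : ∀ n → 0ℚ ℚ.< ι (suc n)
0<ι n = subst (0ℚ ℚ.<_) (sym (ι-suc n)) (ℚ.+-mono-<-≤ (ℚ.positive⁻¹ 1ℚ) (0≤ι n))

ι-mono : ∀ {m n} → m ℕ.≤ n → ι m ℚ.≤ ι n
ι-mono {m} {n} m≤n = subst (λ k → ι m ℚ.≤ ι k) (ℕ.m+[n∸m]≡n m≤n)
  (subst₂ ℚ._≤_ (ℚ.+-identityʳ (ι m)) (sym (ι-+ m (n ℕ.∸ m))) (ℚ.+-monoʳ-≤ (ι m) (0≤ι (n ℕ.∸ m))))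

0<½* : ∀ {ε} → 0ℚ ℚ.< ε → 0ℚ ℚ.< ½ ℚ.* ε
0<½* {ε} ε>0 = ℚ.positive⁻¹ _ {{ℚ.pos*pos⇒pos ½ ε {{ℚ.positive ε>0}}}}

*-pos : ∀ {p q} → 0ℚ ℚ.< p → 0ℚ ℚ.< q → 0ℚ ℚ.< p ℚ.* q
*-pos {p} {q} p>0 q>0 = ℚ.positive⁻¹ _ {{ℚ.pos*pos⇒pos p {{ℚ.positive p>0}} q {{ℚ.positive q>0}}}}

*-mono-≤₀ : ∀ {p p′ q q′} → 0ℚ ℚ.≤ p → 0ℚ ℚ.≤ q′ → p ℚ.≤ p′ → q ℚ.≤ q′ → p ℚ.* q ℚ.≤ p′ ℚ.* q′
*-mono-≤₀ {p} {p′} {q} {q′} 0≤p 0≤q′ p≤p′ q≤q′ = ℚ.≤-trans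
  (ℚ.*-monoˡ-≤-nonNeg p {{ℚ.nonNegative 0≤p}} q≤q′)
  (ℚ.*-monoʳ-≤-nonNeg q′ {{ℚ.nonNegative 0≤q′}} p≤p′)

halves : ∀ ε → ½ ℚ.* ε ℚ.+ ½ ℚ.* ε ≡ ε
halves = solve 1 (λ e → con ½ :* e :+ con ½ :* e := e) refl

p≤∣p∣ : ∀ p → p ℚ.≤ ∣ p ∣
p≤∣p∣ p with ℚ.≤-total 0ℚ p
... | inj₁ 0≤p = ℚ.≤-reflexive (sym (ℚ.0≤p⇒∣p∣≡p 0≤p))
... | inj₂ p≤0 = ℚ.≤-trans p≤0 (ℚ.0≤∣p∣ p)

∣p-q∣-sym : ∀ p q → ∣ p ℚ.- q ∣ ≡ ∣ q ℚ.- p ∣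
∣p-q∣-sym p q = trans (sym (ℚ.∣-p∣≡∣p∣ (p ℚ.- q)))
  (cong ∣_∣ (solve 2 (λ p q → :- (p :- q) := q :- p) refl p q))

triangle : ∀ p q r → ∣ p ℚ.- r ∣ ℚ.≤ ∣ p ℚ.- q ∣ ℚ.+ ∣ q ℚ.- r ∣
triangle p q r = subst (λ t → ∣ t ∣ ℚ.≤ ∣ p ℚ.- q ∣ ℚ.+ ∣ q ℚ.- r ∣)
  (solve 3 (λ p q r → (p :- q) :+ (q :- r) := p :- r) refl p q r)
  (ℚ.∣p+q∣≤∣p∣+∣q∣ (p ℚ.- q) (q ℚ.- r))

near⇒≤ : ∀ p q {ε} → ∣ p ℚ.- q ∣ ℚ.≤ ε → p ℚ.≤ q ℚ.+ ε
near⇒≤ p q {ε} h = subst (ℚ._≤ q ℚ.+ ε) (solve 2 (λ p q → q :+ (p :- q) := p) refl p q)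
  (ℚ.+-monoʳ-≤ q (ℚ.≤-trans (p≤∣p∣ _) h))

-- Real numbers as rational Cauchy sequences with a modulus of convergence.
record ℝ : Set where
  field
    seq    : ℕ → ℚ
    cauchy : ∀ ε → 0ℚ ℚ.< ε → ∃[ N ] ∀ m n → N ℕ.≤ m → N ℕ.≤ n → ∣ seq m ℚ.- seq n ∣ ℚ.≤ ε

open ℝ public

infix 4 _≤_ _<_

-- Records, so that x and y can be inferred from the type x ≤ y.
record _≤_ (x y : ℝ) : Set where
  constructor mk≤
  field
    eventually≤ : ∀ ε → 0ℚ ℚ.< ε → ∃[ N ] ∀ n → N ℕ.≤ n → seq x n ℚ.≤ seq y n ℚ.+ ε

record _<_ (x y : ℝ) : Set where
  constructor mk<
  field
    gap         : ℚ
    gap>0       : 0ℚ ℚ.< gap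
    from        : ℕ
    eventually< : ∀ n → from ℕ.≤ n → seq x n ℚ.+ gap ℚ.≤ seq y n

open _≤_ public

fromℚ : ℚ → ℝ
fromℚ q .seq _ = q
fromℚ q .cauchy ε ε>0 = 0 , λ _ _ _ _ →
  subst (λ t → ∣ t ∣ ℚ.≤ ε) (sym (ℚ.+-inverseʳ q)) (ℚ.<⇒≤ ε>0)

fromℕ : ℕ → ℝ
fromℕ n = fromℚ (ι n)

0ℝ : ℝ
0ℝ = fromℚ 0ℚ

infixl 6 _+_ _-_
infix 8 -_
infixl 7 _·_

_+_ : ℝ → ℝ → ℝ
(x + y) .seq n = seq x n ℚ.+ seq y n
(x + y) .cauchy ε ε>0 =
  let M , hM = cauchy x (½ ℚ.* ε) (0<½* ε>0)
      N , hN = cauchy y (½ ℚ.* ε) (0<½* ε>0)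
  in M ⊔ N , λ m n m≥ n≥ → subst₂ ℚ._≤_
       (cong ∣_∣ (solve 4 (λ a b c d → (a :- c) :+ (b :- d) := (a :+ b) :- (c :+ d)) refl
         (seq x m) (seq y m) (seq x n) (seq y n)))
       (halves ε)
       (ℚ.≤-trans (ℚ.∣p+q∣≤∣p∣+∣q∣ (seq x m ℚ.- seq x n) (seq y m ℚ.- seq y n))
         (ℚ.+-mono-≤ (hM m n (ℕ.m⊔n≤o⇒m≤o M N m≥) (ℕ.m⊔n≤o⇒m≤o M N n≥))
                     (hN m n (ℕ.m⊔n≤o⇒n≤o M N m≥) (ℕ.m⊔n≤o⇒n≤o M N n≥))))

-_ : ℝ → ℝ
(- x) .seq n = ℚ.- seq x n
(- x) .cauchy ε ε>0 = let N , h = cauchy x ε ε>0 in N , λ m n m≥ n≥ →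
  subst (ℚ._≤ ε) (trans (sym (ℚ.∣-p∣≡∣p∣ _)) (cong ∣_∣ (ℚ.neg-distrib-+ (seq x m) (ℚ.- seq x n)))) (h m n m≥ n≥)

_-_ : ℝ → ℝ → ℝ
x - y = x + (- y)

_·_ : ℕ → ℝ → ℝ
zero  · x = 0ℝ
suc n · x = x + n · x

≤-refl : ∀ x → x ≤ x
≤-refl x .eventually≤ ε ε>0 = 0 , λ n _ → subst (ℚ._≤ seq x n ℚ.+ ε) (ℚ.+-identityʳ _) (ℚ.+-monoʳ-≤ (seq x n) (ℚ.<⇒≤ ε>0))

≤-trans : ∀ {x y z} → x ≤ y → y ≤ z → x ≤ z
≤-trans {x} {y} {z} (mk≤ p) (mk≤ q) .eventually≤ ε ε>0 =
  let M , hM = p (½ ℚ.* ε) (0<½* ε>0)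
      N , hN = q (½ ℚ.* ε) (0<½* ε>0)
  in M ⊔ N , λ n n≥ → ℚ.≤-trans (hM n (ℕ.m⊔n≤o⇒m≤o M N n≥))
       (subst (seq y n ℚ.+ ½ ℚ.* ε ℚ.≤_)
         (trans (ℚ.+-assoc (seq z n) _ _) (cong (seq z n ℚ.+_) (halves ε)))
         (ℚ.+-monoˡ-≤ (½ ℚ.* ε) (hN n (ℕ.m⊔n≤o⇒n≤o M N n≥))))

<⇒≤ : ∀ {x y} → x < y → x ≤ y
<⇒≤ {x} {y} (mk< δ δ>0 N h) .eventually≤ ε ε>0 = N , λ n n≥ → begin
  seq x n          ≡⟨ sym (ℚ.+-identityʳ _) ⟩
  seq x n ℚ.+ 0ℚ   ≤⟨ ℚ.+-monoʳ-≤ (seq x n) (ℚ.<⇒≤ δ>0) ⟩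
  seq x n ℚ.+ δ    ≤⟨ h n n≥ ⟩
  seq y n          ≡⟨ sym (ℚ.+-identityʳ _) ⟩
  seq y n ℚ.+ 0ℚ   ≤⟨ ℚ.+-monoʳ-≤ (seq y n) (ℚ.<⇒≤ ε>0) ⟩
  seq y n ℚ.+ ε    ∎
  where open ℚ.≤-Reasoning

≮⇒≥ : ∀ {x y} → ¬ (x < y) → y ≤ x
≮⇒≥ {x} {y} x≮y .eventually≤ ε ε>0 = K , λ n n≥ → ℚ.≮⇒≥ (λ lt → x≮y (mk< δ δ>0 K (strict n n≥ lt)))
  where
  M = proj₁ (cauchy x (½ ℚ.* (½ ℚ.* ε)) (0<½* (0<½* ε>0)))
  N = proj₁ (cauchy y (½ ℚ.* (½ ℚ.* ε)) (0<½* (0<½* ε>0)))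
  hM = proj₂ (cauchy x (½ ℚ.* (½ ℚ.* ε)) (0<½* (0<½* ε>0)))
  hN = proj₂ (cauchy y (½ ℚ.* (½ ℚ.* ε)) (0<½* (0<½* ε>0)))
  K = M ⊔ N
  δ = ½ ℚ.* ε
  δ>0 = 0<½* ε>0
  strict : ∀ n → K ℕ.≤ n → seq x n ℚ.+ ε ℚ.< seq y n → ∀ m → K ℕ.≤ m → seq x m ℚ.+ δ ℚ.≤ seq y m
  strict n n≥ lt m m≥ = subst₂ ℚ._≤_
    (solve 3 (λ a e b → (a :+ b) :- con ½ :* b := a :+ con ½ :* b) refl (seq x m) ε ε)
    (solve 2 (λ a e → (a :+ con ½ :* (con ½ :* e)) :+ con ½ :* (con ½ :* e) :- con ½ :* e := a) refl (seq y m) ε)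
    (ℚ.+-monoˡ-≤ (ℚ.- (½ ℚ.* ε)) (begin
      seq x m ℚ.+ ε  ≤⟨ ℚ.+-monoˡ-≤ ε (near⇒≤ (seq x m) (seq x n) (hM m n (ℕ.m⊔n≤o⇒m≤o M N m≥) (ℕ.m⊔n≤o⇒m≤o M N n≥))) ⟩
      (seq x n ℚ.+ η) ℚ.+ ε ≡⟨ solve 3 (λ a b c → a :+ b :+ c := a :+ c :+ b) refl (seq x n) η ε ⟩
      (seq x n ℚ.+ ε) ℚ.+ η ≤⟨ ℚ.+-monoˡ-≤ η (ℚ.<⇒≤ lt) ⟩
      seq y n ℚ.+ η  ≤⟨ ℚ.+-monoˡ-≤ η (near⇒≤ (seq y n) (seq y m) (hN n m (ℕ.m⊔n≤o⇒n≤o M N n≥) (ℕ.m⊔n≤o⇒n≤o M N m≥))) ⟩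
      (seq y m ℚ.+ η) ℚ.+ η ∎))
    where
    open ℚ.≤-Reasoning
    η = ½ ℚ.* (½ ℚ.* ε)

fromℕ-mono : ∀ {m n} → m ℕ.≤ n → fromℕ m ≤ fromℕ n
fromℕ-mono m≤n .eventually≤ ε ε>0 = 0 , λ n _ → subst (ℚ._≤ _) (ℚ.+-identityʳ _) (ℚ.+-mono-≤ (ι-mono m≤n) (ℚ.<⇒≤ ε>0))

½<1 : ½ ℚ.< 1ℚ
½<1 = ℚ.*<* (ℤ.+<+ (ℕ.s≤s (ℕ.s≤s ℕ.z≤n)))

fromℕ-cancel : ∀ {m n} → fromℕ m ≤ fromℕ n → m ℕ.≤ n
fromℕ-cancel {m} {n} h with m ℕ.≤? n
... | yes m≤n = m≤n
... | no  m≰n = contradiction (ℚ.≤-<-trans (ℚ.≤-trans (ι-mono (ℕ.≰⇒> m≰n)) (proj₂ (eventually≤ h ½ (ℚ.positive⁻¹ ½)) _ ℕ.≤-refl))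
    (subst (ι n ℚ.+ ½ ℚ.<_) (trans (ℚ.+-comm (ι n) 1ℚ) (sym (ι-suc n))) (ℚ.+-monoʳ-< (ι n) ½<1)))
    (ℚ.<-irrefl refl)

∑ : ℕ → (ℕ → ℚ) → ℚ
∑ zero    f = 0ℚ
∑ (suc n) f = ∑ n f ℚ.+ f n

∑-cong : ∀ n {f g : ℕ → ℚ} → (∀ i → f i ≡ g i) → ∑ n f ≡ ∑ n g
∑-cong zero    h = refl
∑-cong (suc n) h = cong₂ ℚ._+_ (∑-cong n h) (h n)

∑-const : ∀ n c → ∑ n (λ _ → c) ≡ ι n ℚ.* c
∑-const zero    c = sym (ℚ.*-zeroˡ c)
∑-const (suc n) c = trans (cong (ℚ._+ c) (∑-const n c))
  (trans (solve 2 (λ m c → m :* c :+ c := (con 1ℚ :+ m) :* c) refl (ι n) c) (cong (ℚ._* c) (sym (ι-suc n))))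

∑-+ : ∀ m n f → ∑ (m ℕ.+ n) f ≡ ∑ m f ℚ.+ ∑ n (λ i → f (m ℕ.+ i))
∑-+ m zero    f = trans (cong (λ k → ∑ k f) (ℕ.+-identityʳ m)) (sym (ℚ.+-identityʳ _))
∑-+ m (suc n) f = trans (cong (λ k → ∑ k f) (ℕ.+-suc m n))
  (trans (cong (ℚ._+ f (m ℕ.+ n)) (∑-+ m n f)) (ℚ.+-assoc (∑ m f) _ _))

∑-* : ∀ m n f → ∑ (m ℕ.* n) f ≡ ∑ m (λ j → ∑ n (λ i → f (j ℕ.* n ℕ.+ i)))
∑-* zero    n f = refl
∑-* (suc m) n f = trans (cong (λ k → ∑ k f) (ℕ.+-comm n (m ℕ.* n)))
  (trans (∑-+ (m ℕ.* n) n f) (cong (ℚ._+ ∑ n (λ i → f (m ℕ.* n ℕ.+ i))) (∑-* m n f)))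

∑-near : ∀ n {f g : ℕ → ℚ} {w B} → 0ℚ ℚ.≤ w →
  (∀ i → i ℕ.< n → ∣ f i ℚ.- g i ∣ ℚ.* w ℚ.≤ B) → ∣ ∑ n f ℚ.- ∑ n g ∣ ℚ.* w ℚ.≤ ι n ℚ.* B
∑-near zero {w = w} {B} 0≤w h = ℚ.≤-reflexive (trans (ℚ.*-zeroˡ w) (sym (ℚ.*-zeroˡ B)))
∑-near (suc n) {f} {g} {w} {B} 0≤w h = begin
  ∣ (∑ n f ℚ.+ f n) ℚ.- (∑ n g ℚ.+ g n) ∣ ℚ.* w
    ≡⟨ cong (λ t → ∣ t ∣ ℚ.* w) (solve 4 (λ a b c d → (a :+ b) :- (c :+ d) := (a :- c) :+ (b :- d)) refl (∑ n f) (f n) (∑ n g) (g n)) ⟩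
  ∣ (∑ n f ℚ.- ∑ n g) ℚ.+ (f n ℚ.- g n) ∣ ℚ.* w
    ≤⟨ ℚ.*-monoʳ-≤-nonNeg w {{ℚ.nonNegative 0≤w}} (ℚ.∣p+q∣≤∣p∣+∣q∣ (∑ n f ℚ.- ∑ n g) (f n ℚ.- g n)) ⟩
  (∣ ∑ n f ℚ.- ∑ n g ∣ ℚ.+ ∣ f n ℚ.- g n ∣) ℚ.* w
    ≡⟨ ℚ.*-distribʳ-+ w ∣ ∑ n f ℚ.- ∑ n g ∣ ∣ f n ℚ.- g n ∣ ⟩
  ∣ ∑ n f ℚ.- ∑ n g ∣ ℚ.* w ℚ.+ ∣ f n ℚ.- g n ∣ ℚ.* w
    ≤⟨ ℚ.+-mono-≤ (∑-near n 0≤w (λ i i<n → h i (ℕ.m≤n⇒m≤1+n i<n))) (h n ℕ.≤-refl) ⟩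
  ι n ℚ.* B ℚ.+ B
    ≡⟨ solve 2 (λ m c → m :* c :+ c := (con 1ℚ :+ m) :* c) refl (ι n) B ⟩
  (1ℚ ℚ.+ ι n) ℚ.* B
    ≡⟨ cong (ℚ._* B) (sym (ι-suc n)) ⟩
  ι (suc n) ℚ.* B ∎
  where open ℚ.≤-Reasoning

infixl 7 _÷⁺_∵_

_÷⁺_∵_ : (p q : ℚ) → 0ℚ ℚ.< q → ℚ
p ÷⁺ q ∵ q>0 = (p ℚ.÷ q) {{ℚ.>-nonZero q>0}}

÷⁺-* : ∀ p q q>0 → (p ÷⁺ q ∵ q>0) ℚ.* q ≡ p
÷⁺-* p q q>0 = trans (ℚ.*-assoc p _ q)
  (trans (cong (p ℚ.*_) (ℚ.*-inverseˡ q {{ℚ.>-nonZero q>0}})) (ℚ.*-identityʳ p))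

÷⁺-near : ∀ x x′ d d′ d>0 d′>0 {c B} → 0ℚ ℚ.≤ c → c ℚ.≤ d → c ℚ.≤ d′ →
  ∣ x ℚ.* d′ ℚ.- x′ ℚ.* d ∣ ℚ.≤ B → ∣ (x ÷⁺ d ∵ d>0) ℚ.- (x′ ÷⁺ d′ ∵ d′>0) ∣ ℚ.* (c ℚ.* c) ℚ.≤ B
÷⁺-near x x′ d d′ d>0 d′>0 {c} {B} 0≤c c≤d c≤d′ h = begin
  ∣ e ∣ ℚ.* (c ℚ.* c)       ≤⟨ ℚ.*-monoˡ-≤-nonNeg ∣ e ∣ {{ℚ.nonNegative (ℚ.0≤∣p∣ e)}} (*-mono-≤₀ 0≤c (ℚ.<⇒≤ d′>0) c≤d c≤d′) ⟩
  ∣ e ∣ ℚ.* (d ℚ.* d′)      ≡⟨ cong (∣ e ∣ ℚ.*_) (sym (ℚ.0≤p⇒∣p∣≡p (ℚ.<⇒≤ (*-pos d>0 d′>0)))) ⟩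
  ∣ e ∣ ℚ.* ∣ d ℚ.* d′ ∣    ≡⟨ sym (ℚ.∣p*q∣≡∣p∣*∣q∣ e (d ℚ.* d′)) ⟩
  ∣ e ℚ.* (d ℚ.* d′) ∣      ≡⟨ cong ∣_∣ (solve 4 (λ u v d d′ → (u :- v) :* (d :* d′) := u :* d :* d′ :- v :* d′ :* d) refl u v d d′) ⟩
  ∣ u ℚ.* d ℚ.* d′ ℚ.- v ℚ.* d′ ℚ.* d ∣ ≡⟨ cong₂ (λ s t → ∣ s ℚ.* d′ ℚ.- t ℚ.* d ∣) (÷⁺-* x d d>0) (÷⁺-* x′ d′ d′>0) ⟩
  ∣ x ℚ.* d′ ℚ.- x′ ℚ.* d ∣ ≤⟨ h ⟩
  B ∎
  where
  open ℚ.≤-Reasoning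
  u = x ÷⁺ d ∵ d>0
  v = x′ ÷⁺ d′ ∵ d′>0
  e = u ℚ.- v

÷⁺-unique : ∀ {p q r} q>0 → r ℚ.* q ≡ p → p ÷⁺ q ∵ q>0 ≡ r
÷⁺-unique {q = q} {r} q>0 refl = trans (ℚ.*-assoc r q _)
  (trans (cong (r ℚ.*_) (ℚ.*-inverseʳ q {{ℚ.>-nonZero q>0}})) (ℚ.*-identityʳ r))

-- riemann m is the left Riemann sum of ∫₁^q dt/t on M = suc m equal pieces,
-- oriented as the integral is when q < 1: with step h = (q - 1)/M the sum is
-- Σ_{j<M} h/(1 + jh), and M (1 + jh) = (M - j) + jq, which is den M j q.
den : ℕ → ℕ → ℚ → ℚ
den m j q = ι (m ℕ.∸ j) ℚ.+ ι j ℚ.* q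

den>0 : ∀ m j {q} → 0ℚ ℚ.< q → 0ℚ ℚ.< den (suc m) j q
den>0 m zero    {q} q>0 = subst (0ℚ ℚ.<_) (sym (trans (cong (ι (suc m) ℚ.+_) (ℚ.*-zeroˡ q)) (ℚ.+-identityʳ _))) (0<ι m)
den>0 m (suc j) {q} q>0 = ℚ.+-mono-≤-< (0≤ι (m ℕ.∸ j)) (*-pos (0<ι j) q>0)

riemann : ℕ → (q : ℚ) → 0ℚ ℚ.< q → ℚ
riemann m q q>0 = ∑ (suc m) (λ j → (q ℚ.- 1ℚ) ÷⁺ den (suc m) j q ∵ den>0 m j q>0)

module _ {a : ℚ} (a>0 : 0ℚ ℚ.< a) (a≤1 : a ℚ.≤ 1ℚ) where

  private
    0≤a : 0ℚ ℚ.≤ a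
    0≤a = ℚ.<⇒≤ a>0

    ι-split : ∀ {m j} → j ℕ.≤ m → ι (m ℕ.∸ j) ℚ.+ ι j ≡ ι m
    ι-split {m} {j} j≤m = trans (sym (ι-+ (m ℕ.∸ j) j)) (cong ι (ℕ.m∸n+n≡m j≤m))

    den≥ : ∀ {m j q} → j ℕ.≤ m → a ℚ.≤ q → ι m ℚ.* a ℚ.≤ den m j q
    den≥ {m} {j} {q} j≤m a≤q = begin
      ι m ℚ.* a ≡⟨ cong (ℚ._* a) (sym (ι-split j≤m)) ⟩
      (ι (m ℕ.∸ j) ℚ.+ ι j) ℚ.* a ≡⟨ ℚ.*-distribʳ-+ a (ι (m ℕ.∸ j)) (ι j) ⟩
      ι (m ℕ.∸ j) ℚ.* a ℚ.+ ι j ℚ.* a ≤⟨ ℚ.+-mono-≤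
          (ℚ.*-monoˡ-≤-nonNeg (ι (m ℕ.∸ j)) {{ℚ.nonNegative (0≤ι (m ℕ.∸ j))}} a≤1)
          (ℚ.*-monoˡ-≤-nonNeg (ι j) {{ℚ.nonNegative (0≤ι j)}} a≤q) ⟩
      ι (m ℕ.∸ j) ℚ.* 1ℚ ℚ.+ ι j ℚ.* q ≡⟨ cong (ℚ._+ ι j ℚ.* q) (ℚ.*-identityʳ (ι (m ℕ.∸ j))) ⟩
      den m j q ∎
      where open ℚ.≤-Reasoning

  riemann-lipschitz : ∀ m q q′ q>0 q′>0 → a ℚ.≤ q → a ℚ.≤ q′ →
    ∣ riemann m q q>0 ℚ.- riemann m q′ q′>0 ∣ ℚ.* (a ℚ.* a) ℚ.≤ ∣ q ℚ.- q′ ∣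
  riemann-lipschitz m q q′ q>0 q′>0 a≤q a≤q′ =
    ℚ.*-cancelʳ-≤-pos (M ℚ.* M) {{ℚ.positive (*-pos (0<ι m) (0<ι m))}} (begin
      E ℚ.* (a ℚ.* a) ℚ.* (M ℚ.* M)        ≡⟨ solve 3 (λ E a M → E :* (a :* a) :* (M :* M) := E :* ((M :* a) :* (M :* a))) refl E a M ⟩
      E ℚ.* ((M ℚ.* a) ℚ.* (M ℚ.* a))      ≤⟨ ∑-near (suc m) (*-mono-≤₀ (ℚ.≤-refl {0ℚ}) 0≤Ma 0≤Ma 0≤Ma) step ⟩
      M ℚ.* (M ℚ.* ∣ q ℚ.- q′ ∣)           ≡⟨ solve 2 (λ M d → M :* (M :* d) := d :* (M :* M)) refl M ∣ q ℚ.- q′ ∣ ⟩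
      ∣ q ℚ.- q′ ∣ ℚ.* (M ℚ.* M)           ∎)
    where
    open ℚ.≤-Reasoning
    module Eq = ≡.≡-Reasoning
    M = ι (suc m)
    E = ∣ riemann m q q>0 ℚ.- riemann m q′ q′>0 ∣
    0≤Ma : 0ℚ ℚ.≤ M ℚ.* a
    0≤Ma = ℚ.<⇒≤ (*-pos (0<ι m) a>0)
    step : ∀ j → j ℕ.< suc m → _
    step j j<m = ÷⁺-near (q ℚ.- 1ℚ) (q′ ℚ.- 1ℚ) _ _ (den>0 m j q>0) (den>0 m j q′>0) 0≤Ma
      (den≥ (ℕ.<⇒≤ j<m) a≤q) (den≥ (ℕ.<⇒≤ j<m) a≤q′) (ℚ.≤-reflexive (Eq.begin
        ∣ (q ℚ.- 1ℚ) ℚ.* den (suc m) j q′ ℚ.- (q′ ℚ.- 1ℚ) ℚ.* den (suc m) j q ∣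
          Eq.≡⟨ cong ∣_∣ (solve 4 (λ q q′ s t → (q :- con 1ℚ) :* (s :+ t :* q′) :- (q′ :- con 1ℚ) :* (s :+ t :* q) := (s :+ t) :* (q :- q′)) refl q q′ (ι (suc m ℕ.∸ j)) (ι j)) ⟩
        ∣ (ι (suc m ℕ.∸ j) ℚ.+ ι j) ℚ.* (q ℚ.- q′) ∣
          Eq.≡⟨ cong (λ t → ∣ t ℚ.* (q ℚ.- q′) ∣) (ι-split (ℕ.<⇒≤ j<m)) ⟩
        ∣ M ℚ.* (q ℚ.- q′) ∣
          Eq.≡⟨ ℚ.∣p*q∣≡∣p∣*∣q∣ M (q ℚ.- q′) ⟩
        ∣ M ∣ ℚ.* ∣ q ℚ.- q′ ∣
          Eq.≡⟨ cong (ℚ._* ∣ q ℚ.- q′ ∣) (ℚ.0≤p⇒∣p∣≡p (0≤ι (suc m))) ⟩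
        M ℚ.* ∣ q ℚ.- q′ ∣ Eq.∎))

  private
    den≡ : ∀ {m j} q → j ℕ.≤ m → den m j q ≡ ι m ℚ.+ ι j ℚ.* (q ℚ.- 1ℚ)
    den≡ {m} {j} q j≤m = trans
      (solve 3 (λ s t q → s :+ t :* q := (s :+ t) :+ t :* (q :- con 1ℚ)) refl (ι (m ℕ.∸ j)) (ι j) q)
      (cong (ℚ._+ ι j ℚ.* (q ℚ.- 1ℚ)) (ι-split j≤m))

  riemann-refine : ∀ m k q q>0 → a ℚ.≤ q →
    ∣ riemann m q q>0 ℚ.- riemann (k ℕ.+ m ℕ.* suc k) q q>0 ∣ ℚ.* (a ℚ.* a ℚ.* ι (suc m)) ℚ.≤ ∣ q ℚ.- 1ℚ ∣ ℚ.* ∣ q ℚ.- 1ℚ ∣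
  riemann-refine m k q q>0 a≤q =
    ℚ.*-cancelʳ-≤-pos (M ℚ.* (K ℚ.* K)) {{ℚ.positive (*-pos (0<ι m) (*-pos (0<ι k) (0<ι k)))}} (begin
      E ℚ.* (a ℚ.* a ℚ.* M) ℚ.* (M ℚ.* (K ℚ.* K))
        ≡⟨ solve 4 (λ E a M K → E :* (a :* a :* M) :* (M :* (K :* K)) := E :* ((M :* K :* a) :* (M :* K :* a))) refl E a M K ⟩
      E ℚ.* w
        ≡⟨ cong (λ t → ∣ t ∣ ℚ.* w) (cong₂ ℚ._-_ (∑-cong (suc m) split) (∑-* (suc m) (suc k) g)) ⟩
      ∣ ∑ (suc m) (λ j → ∑ (suc k) (λ _ → c j)) ℚ.- ∑ (suc m) (λ j → ∑ (suc k) (λ i → g (j ℕ.* suc k ℕ.+ i))) ∣ ℚ.* w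
        ≤⟨ ∑-near (suc m) 0≤w (λ j j<m → ∑-near (suc k) 0≤w (λ i i<k → step j i j<m i<k)) ⟩
      M ℚ.* (K ℚ.* (K ℚ.* Q))
        ≡⟨ solve 3 (λ M K Q → M :* (K :* (K :* Q)) := Q :* (M :* (K :* K))) refl M K Q ⟩
      Q ℚ.* (M ℚ.* (K ℚ.* K)) ∎)
    where
    open ℚ.≤-Reasoning
    module Eq = ≡.≡-Reasoning
    M = ι (suc m)
    K = ι (suc k)
    MK = suc m ℕ.* suc k
    E = ∣ riemann m q q>0 ℚ.- riemann (k ℕ.+ m ℕ.* suc k) q q>0 ∣
    h = q ℚ.- 1ℚ
    Q = ∣ h ∣ ℚ.* ∣ h ∣
    w = (M ℚ.* K ℚ.* a) ℚ.* (M ℚ.* K ℚ.* a)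
    0≤MKa : 0ℚ ℚ.≤ M ℚ.* K ℚ.* a
    0≤MKa = ℚ.<⇒≤ (*-pos (*-pos (0<ι m) (0<ι k)) a>0)
    0≤w : 0ℚ ℚ.≤ w
    0≤w = *-mono-≤₀ (ℚ.≤-refl {0ℚ}) 0≤MKa 0≤MKa 0≤MKa
    Kd>0 : ∀ j → 0ℚ ℚ.< K ℚ.* den (suc m) j q
    Kd>0 j = *-pos (0<ι k) (den>0 m j q>0)
    c : ℕ → ℚ
    c j = h ÷⁺ K ℚ.* den (suc m) j q ∵ Kd>0 j
    g : ℕ → ℚ
    g j = h ÷⁺ den MK j q ∵ den>0 (k ℕ.+ m ℕ.* suc k) j q>0
    split : ∀ j → h ÷⁺ den (suc m) j q ∵ den>0 m j q>0 ≡ ∑ (suc k) (λ _ → c j)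
    split j = trans (÷⁺-unique (den>0 m j q>0)
        (trans (solve 3 (λ K c d → K :* c :* d := c :* (K :* d)) refl K (c j) (den (suc m) j q))
          (÷⁺-* h _ (Kd>0 j))))
      (sym (∑-const (suc k) (c j)))
    step : ∀ j i → j ℕ.< suc m → i ℕ.< suc k → _
    step j i j<m i<k = ÷⁺-near h h _ _ (Kd>0 j) (den>0 (k ℕ.+ m ℕ.* suc k) (j ℕ.* suc k ℕ.+ i) q>0) 0≤MKa
      (subst (ℚ._≤ K ℚ.* den (suc m) j q) (solve 3 (λ M K a → K :* (M :* a) := M :* K :* a) refl M K a)
        (ℚ.*-monoˡ-≤-nonNeg K {{ℚ.nonNegative (0≤ι (suc k))}} (den≥ (ℕ.<⇒≤ j<m) a≤q)))
      (subst (λ t → t ℚ.* a ℚ.≤ den MK (j ℕ.* suc k ℕ.+ i) q) (ι-* (suc m) (suc k)) (den≥ l≤MK a≤q))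
      (begin
        ∣ h ℚ.* den MK (j ℕ.* suc k ℕ.+ i) q ℚ.- h ℚ.* (K ℚ.* den (suc m) j q) ∣
          ≡⟨ cong ∣_∣ diff ⟩
        ∣ ι i ℚ.* (h ℚ.* h) ∣
          ≡⟨ ℚ.∣p*q∣≡∣p∣*∣q∣ (ι i) (h ℚ.* h) ⟩
        ∣ ι i ∣ ℚ.* ∣ h ℚ.* h ∣
          ≡⟨ cong₂ ℚ._*_ (ℚ.0≤p⇒∣p∣≡p (0≤ι i)) (ℚ.∣p*q∣≡∣p∣*∣q∣ h h) ⟩
        ι i ℚ.* Q
          ≤⟨ ℚ.*-monoʳ-≤-nonNeg Q {{ℚ.nonNegative 0≤Q}} (ι-mono (ℕ.<⇒≤ i<k)) ⟩
        K ℚ.* Q ∎)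
      where
      0≤Q : 0ℚ ℚ.≤ Q
      0≤Q = *-mono-≤₀ (ℚ.≤-refl {0ℚ}) (ℚ.0≤∣p∣ h) (ℚ.0≤∣p∣ h) (ℚ.0≤∣p∣ h)
      l≤MK : j ℕ.* suc k ℕ.+ i ℕ.≤ MK
      l≤MK = ℕ.≤-trans (ℕ.+-monoʳ-≤ (j ℕ.* suc k) (ℕ.<⇒≤ i<k))
        (ℕ.≤-trans (ℕ.≤-reflexive (ℕ.+-comm (j ℕ.* suc k) (suc k))) (ℕ.*-monoˡ-≤ (suc k) j<m))
      diff : h ℚ.* den MK (j ℕ.* suc k ℕ.+ i) q ℚ.- h ℚ.* (K ℚ.* den (suc m) j q) ≡ ι i ℚ.* (h ℚ.* h)
      diff = Eq.begin
        h ℚ.* den MK (j ℕ.* suc k ℕ.+ i) q ℚ.- h ℚ.* (K ℚ.* den (suc m) j q)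
          Eq.≡⟨ cong₂ (λ s t → h ℚ.* s ℚ.- h ℚ.* (K ℚ.* t)) (den≡ q l≤MK) (den≡ q (ℕ.<⇒≤ j<m)) ⟩
        h ℚ.* (ι MK ℚ.+ ι (j ℕ.* suc k ℕ.+ i) ℚ.* h) ℚ.- h ℚ.* (K ℚ.* (M ℚ.+ ι j ℚ.* h))
          Eq.≡⟨ cong₂ (λ s t → h ℚ.* (s ℚ.+ t ℚ.* h) ℚ.- h ℚ.* (K ℚ.* (M ℚ.+ ι j ℚ.* h))) (ι-* (suc m) (suc k))
                 (trans (ι-+ (j ℕ.* suc k) i) (cong (ℚ._+ ι i) (ι-* j (suc k)))) ⟩
        h ℚ.* (M ℚ.* K ℚ.+ (ι j ℚ.* K ℚ.+ ι i) ℚ.* h) ℚ.- h ℚ.* (K ℚ.* (M ℚ.+ ι j ℚ.* h))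
          Eq.≡⟨ solve 5 (λ h M K j i → h :* (M :* K :+ (j :* K :+ i) :* h) :- h :* (K :* (M :+ j :* h)) := i :* (h :* h)) refl h M K (ι j) (ι i) ⟩
        ι i ℚ.* (h ℚ.* h) Eq.∎

ℚ-archimedean : ∀ p → ∃[ n ] p ℚ.≤ ι n
ℚ-archimedean p@(ℚ.mkℚ n d _) = ℤ.∣ n ∣ , ℚ.toℚᵘ-cancel-≤
  (ℚᵘ.≤-respʳ-≃ (ℚᵘ.≃-sym (ℚ.toℚᵘ-fromℚᵘ (ℚᵘ.mkℚᵘ (+ ℤ.∣ n ∣) 0))) (ℚᵘ.*≤* le))
  where
  le : n ℤ.* + 1 ℤ.≤ + ℤ.∣ n ∣ ℤ.* + suc d
  le = ℤ.≤-trans (ℤ.≤-reflexive (ℤ.*-identityʳ n)) (ℤ.≤-trans (i≤∣i∣ n)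
    (subst (+ ℤ.∣ n ∣ ℤ.≤_) (ℤ.pos-* ℤ.∣ n ∣ (suc d)) (ℤ.+≤+ (ℕ.m≤m*n ℤ.∣ n ∣ (suc d)))))
    where
    i≤∣i∣ : ∀ i → i ℤ.≤ + ℤ.∣ i ∣
    i≤∣i∣ (+ n)      = ℤ.≤-refl
    i≤∣i∣ ℤ.-[1+ n ] = ℤ.-≤+

ℚ-archimedean* : ∀ p {r} → 0ℚ ℚ.< r → ∃[ n ] p ℚ.≤ ι n ℚ.* r
ℚ-archimedean* p {r} r>0 = let n , h = ℚ-archimedean (p ÷⁺ r ∵ r>0) in n ,
  subst (ℚ._≤ ι n ℚ.* r) (÷⁺-* p r r>0) (ℚ.*-monoʳ-≤-nonNeg r {{ℚ.nonNegative (ℚ.<⇒≤ r>0)}} h)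

-- The natural logarithm log x = ∫₁^x dt/t: the limit of the Riemann sums of
-- ∫₁^q dt/t as q runs through the approximations of x and the mesh tends to 0.
-- The sequence starts where the approximations stay positive.
log : (x : ℝ) → 0ℝ < x → ℝ
log x (mk< ε ε>0 N x≥ε) = record { seq = s ; cauchy = s-cauchy }
  where
  open ℚ.≤-Reasoning
  x′ : ℕ → ℚ
  x′ n = seq x (N ℕ.+ n)

  ε≤x′ : ∀ n → ε ℚ.≤ x′ n
  ε≤x′ n = subst (ℚ._≤ x′ n) (ℚ.+-identityˡ ε) (x≥ε (N ℕ.+ n) (ℕ.m≤m+n N n))

  x′>0 : ∀ n → 0ℚ ℚ.< x′ n
  x′>0 n = ℚ.<-≤-trans ε>0 (ε≤x′ n)

  s : ℕ → ℚ
  s n = riemann n (x′ n) (x′>0 n)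

  a : ℚ
  a = ε ℚ.⊓ 1ℚ

  a>0 : 0ℚ ℚ.< a
  a>0 with ℚ.⊓-sel ε 1ℚ
  ... | inj₁ e = subst (0ℚ ℚ.<_) (sym e) ε>0
  ... | inj₂ e = subst (0ℚ ℚ.<_) (sym e) (ℚ.positive⁻¹ 1ℚ)

  a≤1 : a ℚ.≤ 1ℚ
  a≤1 = ℚ.p⊓q≤q ε 1ℚ

  a≤x′ : ∀ n → a ℚ.≤ x′ n
  a≤x′ n = ℚ.≤-trans (ℚ.p⊓q≤p ε 1ℚ) (ε≤x′ n)

  aa>0 : 0ℚ ℚ.< a ℚ.* a
  aa>0 = *-pos a>0 a>0

  N₁ : ℕ
  N₁ = proj₁ (cauchy x 1ℚ (ℚ.positive⁻¹ 1ℚ))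

  B : ℚ
  B = 1ℚ ℚ.+ ∣ seq x N₁ ℚ.- 1ℚ ∣

  bounded : ∀ n → N₁ ℕ.≤ n → ∣ x′ n ℚ.- 1ℚ ∣ ℚ.≤ B
  bounded n n≥ = ℚ.≤-trans (triangle (x′ n) (seq x N₁) 1ℚ)
    (ℚ.+-monoˡ-≤ ∣ seq x N₁ ℚ.- 1ℚ ∣ (proj₂ (cauchy x 1ℚ (ℚ.positive⁻¹ 1ℚ)) (N ℕ.+ n) N₁ (ℕ.≤-trans n≥ (ℕ.m≤n+m n N)) ℕ.≤-refl))

  0≤B : 0ℚ ℚ.≤ B
  0≤B = ℚ.+-mono-≤ 0≤1 (ℚ.0≤∣p∣ (seq x N₁ ℚ.- 1ℚ))

  s-cauchy : ∀ δ → 0ℚ ℚ.< δ → ∃[ K ] ∀ m n → K ℕ.≤ m → K ℕ.≤ n → ∣ s m ℚ.- s n ∣ ℚ.≤ δ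
  s-cauchy δ δ>0 = N₁ ⊔ (N₂ ⊔ N₃) , λ m n m≥ n≥ →
    subst (∣ s m ℚ.- s n ∣ ℚ.≤_) (halves δ)
      (ℚ.≤-trans (triangle (s m) (riemann m (x′ n) (x′>0 n)) (s n))
        (ℚ.+-mono-≤ (lips m n (N₂≤ m≥) (N₂≤ n≥)) (mesh m n (N₃≤ m≥) (N₃≤ n≥) (bounded n (N₁≤ n≥)))))
    where
    η θ : ℚ
    η = ½ ℚ.* δ
    θ = ½ ℚ.* η
    η>0 : 0ℚ ℚ.< η
    η>0 = 0<½* δ>0
    θ>0 : 0ℚ ℚ.< θ
    θ>0 = 0<½* η>0

    cx = cauchy x (η ℚ.* (a ℚ.* a)) (*-pos η>0 aa>0)
    ar = ℚ-archimedean* (B ℚ.* B) (*-pos θ>0 aa>0)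
    N₂ = proj₁ cx
    N₃ = proj₁ ar

    N₁≤ : ∀ {m} → N₁ ⊔ (N₂ ⊔ N₃) ℕ.≤ m → N₁ ℕ.≤ m
    N₁≤ = ℕ.m⊔n≤o⇒m≤o N₁ _
    N₂≤ : ∀ {m} → N₁ ⊔ (N₂ ⊔ N₃) ℕ.≤ m → N₂ ℕ.≤ m
    N₂≤ h = ℕ.m⊔n≤o⇒m≤o N₂ N₃ (ℕ.m⊔n≤o⇒n≤o N₁ _ h)
    N₃≤ : ∀ {m} → N₁ ⊔ (N₂ ⊔ N₃) ℕ.≤ m → N₃ ℕ.≤ m
    N₃≤ h = ℕ.m⊔n≤o⇒n≤o N₂ N₃ (ℕ.m⊔n≤o⇒n≤o N₁ _ h)

    lips : ∀ m n → N₂ ℕ.≤ m → N₂ ℕ.≤ n → ∣ s m ℚ.- riemann m (x′ n) (x′>0 n) ∣ ℚ.≤ η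
    lips m n m≥ n≥ = ℚ.*-cancelʳ-≤-pos (a ℚ.* a) {{ℚ.positive aa>0}} (ℚ.≤-trans
      (riemann-lipschitz a>0 a≤1 m (x′ m) (x′ n) (x′>0 m) (x′>0 n) (a≤x′ m) (a≤x′ n))
      (proj₂ cx (N ℕ.+ m) (N ℕ.+ n) (ℕ.≤-trans m≥ (ℕ.m≤n+m m N)) (ℕ.≤-trans n≥ (ℕ.m≤n+m n N))))

    refine : ∀ m k q q>0 → N₃ ℕ.≤ m → a ℚ.≤ q → ∣ q ℚ.- 1ℚ ∣ ℚ.≤ B →
      ∣ riemann m q q>0 ℚ.- riemann (k ℕ.+ m ℕ.* suc k) q q>0 ∣ ℚ.≤ θ
    refine m k q q>0 m≥ a≤q q≤B = ℚ.*-cancelʳ-≤-pos (a ℚ.* a ℚ.* ι (suc m)) {{ℚ.positive (*-pos aa>0 (0<ι m))}} (begin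
      E ℚ.* (a ℚ.* a ℚ.* ι (suc m))  ≤⟨ riemann-refine a>0 a≤1 m k q q>0 a≤q ⟩
      ∣ q ℚ.- 1ℚ ∣ ℚ.* ∣ q ℚ.- 1ℚ ∣  ≤⟨ *-mono-≤₀ (ℚ.0≤∣p∣ _) 0≤B q≤B q≤B ⟩
      B ℚ.* B                        ≤⟨ proj₂ ar ⟩
      ι N₃ ℚ.* (θ ℚ.* (a ℚ.* a))     ≤⟨ ℚ.*-monoʳ-≤-nonNeg _ {{ℚ.nonNegative (ℚ.<⇒≤ (*-pos θ>0 aa>0))}} (ι-mono (ℕ.m≤n⇒m≤1+n m≥)) ⟩
      ι (suc m) ℚ.* (θ ℚ.* (a ℚ.* a)) ≡⟨ solve 3 (λ M t a → M :* (t :* a) := t :* (a :* M)) refl (ι (suc m)) θ (a ℚ.* a) ⟩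
      θ ℚ.* (a ℚ.* a ℚ.* ι (suc m))  ∎)
      where E = ∣ riemann m q q>0 ℚ.- riemann (k ℕ.+ m ℕ.* suc k) q q>0 ∣

    mesh : ∀ m n → N₃ ℕ.≤ m → N₃ ℕ.≤ n → ∣ x′ n ℚ.- 1ℚ ∣ ℚ.≤ B →
      ∣ riemann m (x′ n) (x′>0 n) ℚ.- s n ∣ ℚ.≤ η
    mesh m n m≥ n≥ x≤B = subst (∣ R m ℚ.- R n ∣ ℚ.≤_) (halves η)
      (ℚ.≤-trans (triangle (R m) (R mn) (R n))
        (ℚ.+-mono-≤ (refine m n q q>0 m≥ (a≤x′ n) x≤B)
          (subst (ℚ._≤ θ) (trans (cong (λ k → ∣ R n ℚ.- R k ∣) comm) (∣p-q∣-sym (R n) (R mn)))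
            (refine n m q q>0 n≥ (a≤x′ n) x≤B))))
      where
      q = x′ n
      q>0 = x′>0 n
      mn = n ℕ.+ m ℕ.* suc n
      R : ℕ → ℚ
      R k = riemann k q q>0
      comm : m ℕ.+ n ℕ.* suc m ≡ mn
      comm = ℕ.suc-injective (ℕ.*-comm (suc n) (suc m))

-- Intervals of any kind: open, closed, half-open, degenerate or unbounded.
record Interval : Set₁ where
  field
    points    : Pred ℝ 0ℓ
    convex    : ∀ {x y z} → x ∈ points → z ∈ points → x ≤ y → y ≤ z → y ∈ points
    inhabited : Satisfiable points

open Interval public

record Graph (n : ℕ) : Set₁ where
  infix 4 _~_ _~?_
  field
    _~_      : Rel (Fin n) 0ℓ
    ~-sym    : Symmetric _~_
    ~-irrefl : Irreflexive _≡_ _~_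
    _~?_     : Decidable _~_

IsIntersectionGraph : ∀ {n} → Graph n → (Fin n → Interval) → Set
IsIntersectionGraph G J = ∀ {i j} → i ≢ j → i ~ j ⇔ points (J i) ≬ points (J j)
  where open Graph G

IsIntervalGraph : ∀ {n} → Graph n → Set₁
IsIntervalGraph {n} G = ∃[ J ] IsIntersectionGraph G J

infix 4 _≅_

_≅_ : ∀ {n} → Graph n → Graph n → Set
_≅_ {n} G H = Σ[ π ∈ Permutation′ n ] (∀ i j → i G.~ j ⇔ (π ⟨$⟩ʳ i) H.~ (π ⟨$⟩ʳ j))
  where
  module G = Graph G
  module H = Graph H

≅-refl : ∀ {n} (G : Graph n) → G ≅ G
≅-refl G = Perm.id , λ i j → mk⇔ (λ e → e) (λ e → e)

≅-sym : ∀ {n} (G H : Graph n) → G ≅ H → H ≅ G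
≅-sym G H (π , h) = Perm.flip π , λ i j → mk⇔
  (λ e → Equivalence.from (h _ _) (subst₂ (Graph._~_ H) (sym (Perm.inverseʳ π)) (sym (Perm.inverseʳ π)) e))
  (λ e → subst₂ (Graph._~_ H) (Perm.inverseʳ π) (Perm.inverseʳ π) (Equivalence.to (h _ _) e))

≅-trans : ∀ {n} (G H K : Graph n) → G ≅ H → H ≅ K → G ≅ K
≅-trans G H K (π , f) (ρ , g) = π Perm.∘ₚ ρ , λ i j → mk⇔
  (λ e → Equivalence.to (g _ _) (Equivalence.to (f i j) e))
  (λ e → Equivalence.from (f i j) (Equivalence.from (g _ _) e))

≅-dec : ∀ {n} (G H : Graph n) → Dec (G ≅ H)
≅-dec {n} G H = map′ to from (Fin.any? λ f → Fin.any? λ g → iso? f g)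
  where
  module G = Graph G
  module H = Graph H
  Iso : Fin (n ^ n) → Fin (n ^ n) → Set
  Iso f g = (∀ i → finToFun f (finToFun g i) ≡ i) × (∀ i → finToFun g (finToFun f i) ≡ i) ×
    (∀ i j → (i G.~ j → finToFun f i H.~ finToFun f j) × (finToFun f i H.~ finToFun f j → i G.~ j))
  iso? : ∀ f g → Dec (Iso f g)
  iso? f g = Fin.all? (λ i → finToFun {n} f (finToFun g i) Fin.≟ i) ×-dec Fin.all? (λ i → finToFun {n} g (finToFun f i) Fin.≟ i) ×-dec
    Fin.all? λ i → Fin.all? λ j →
      ((i G.~? j) →-dec (finToFun f i H.~? finToFun f j)) ×-dec ((finToFun f i H.~? finToFun f j) →-dec (i G.~? j))
  to : (∃[ f ] ∃[ g ] Iso f g) → G ≅ H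
  to (f , g , fg , gf , h) = Perm.permutation (finToFun f) (finToFun g) fg gf ,
    λ i j → mk⇔ (proj₁ (h i j)) (proj₂ (h i j))
  from : G ≅ H → ∃[ f ] ∃[ g ] Iso f g
  from (π , h) = funToFin (π ⟨$⟩ʳ_) , funToFin (π ⟨$⟩ˡ_) ,
    (λ i → trans (eqʳ _) (trans (cong (π ⟨$⟩ʳ_) (eqˡ i)) (Perm.inverseʳ π))) ,
    (λ i → trans (eqˡ _) (trans (cong (π ⟨$⟩ˡ_) (eqʳ i)) (Perm.inverseˡ π))) ,
    λ i j → (λ e → subst₂ H._~_ (sym (eqʳ i)) (sym (eqʳ j)) (Equivalence.to (h i j) e)) ,
            (λ e → Equivalence.from (h i j) (subst₂ H._~_ (eqʳ i) (eqʳ j) e))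
    where
    eqʳ : ∀ i → finToFun (funToFin (π ⟨$⟩ʳ_)) i ≡ π ⟨$⟩ʳ i
    eqʳ = Fin.finToFun-funToFin (π ⟨$⟩ʳ_)
    eqˡ : ∀ i → finToFun (funToFin (π ⟨$⟩ˡ_)) i ≡ π ⟨$⟩ˡ i
    eqˡ = Fin.finToFun-funToFin (π ⟨$⟩ˡ_)

IntervalGraph : ℕ → Set₁
IntervalGraph n = Σ (Graph n) IsIntervalGraph

intervalGraphs : ℕ → Setoid (lsuc 0ℓ) 0ℓ
intervalGraphs n = record
  { Carrier       = IntervalGraph n
  ; _≈_           = λ G H → proj₁ G ≅ proj₁ H
  ; isEquivalence = record
    { refl  = λ {G} → ≅-refl (proj₁ G)
    ; sym   = λ {G} {H} → ≅-sym (proj₁ G) (proj₁ H)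
    ; trans = λ {G} {H} {K} → ≅-trans (proj₁ G) (proj₁ H) (proj₁ K)
    }
  }

module _ {a ℓ} (S : Setoid a ℓ) where
  open Setoid S renaming (refl to ≈-refl; sym to ≈-sym; trans to ≈-trans)

  representatives : Decidable _≈_ → ∀ K (f : Fin K → Carrier) →
    ∃[ m ] Σ[ g ∈ (Fin m → Carrier) ] (∀ {a b} → g a ≈ g b → a ≡ b) × (∀ k → ∃[ b ] g b ≈ f k)
  representatives _≟_ zero f = 0 , (λ ()) , (λ { {()} }) , λ ()
  representatives _≟_ (suc K) f with representatives _≟_ K (f ∘ suc)
  ... | m , g , inj , surj with Fin.any? (λ b → g b ≟ f zero)
  ...   | yes hit = m , g , inj , λ { zero → hit ; (suc k) → surj k }
  ...   | no miss = suc m , g′ , inj′ , λ { zero → zero , ≈-refl ; (suc k) → suc (proj₁ (surj k)) , proj₂ (surj k) }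
    where
    g′ : Fin (suc m) → Carrier
    g′ zero    = f zero
    g′ (suc b) = g b
    inj′ : ∀ {a b} → g′ a ≈ g′ b → a ≡ b
    inj′ {zero}  {zero}  _ = refl
    inj′ {zero}  {suc b} e = contradiction (b , ≈-sym e) miss
    inj′ {suc a} {zero}  e = contradiction (a , e) miss
    inj′ {suc a} {suc b} e = cong suc (inj e)

  finite : Decidable _≈_ → ∀ K (f : Fin K → Carrier) → (∀ x → ∃[ k ] f k ≈ x) →
    ∃[ m ] Bijection (≡.setoid (Fin m)) S
  finite _≟_ K f onto with representatives _≟_ K f
  ... | m , g , inj , surj = m , record
    { to        = g
    ; cong      = λ { refl → ≈-refl }
    ; bijective = inj , λ x → let k , fk≈x = onto x ; b , gb≈fk = surj k in
        b , λ { refl → ≈-trans gb≈fk fk≈x }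
    }

[_,_]⟨_⟩ : (x y : ℝ) → x ≤ y → Interval
[ x , y ]⟨ x≤y ⟩ = record
  { points    = λ z → x ≤ z × z ≤ y
  ; convex    = λ (x≤u , _) (_ , w≤y) u≤v v≤w → ≤-trans x≤u u≤v , ≤-trans v≤w w≤y
  ; inhabited = x , ≤-refl x , x≤y
  }

-- The right end of vertex i is l i ⊔ r i, so that every pair l, r is admissible.
module _ {n : ℕ} (l r : Fin n → ℕ) where

  endpointsGraph : Graph n
  endpointsGraph = record
    { _~_      = λ i j → i ≢ j × l i ℕ.≤ l j ⊔ r j × l j ℕ.≤ l i ⊔ r i
    ; ~-sym    = λ (i≢j , p , q) → i≢j ∘ sym , q , p
    ; ~-irrefl = λ i≡j (i≢j , _) → i≢j i≡j
    ; _~?_     = λ i j → ¬? (i Fin.≟ j) ×-dec (l i ℕ.≤? l j ⊔ r j) ×-dec (l j ℕ.≤? l i ⊔ r i)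
    }

  endpointsGraph-isIntervalGraph : IsIntervalGraph endpointsGraph
  endpointsGraph-isIntervalGraph = J , λ i≢j → mk⇔ (to i≢j) (from i≢j)
    where
    J : Fin n → Interval
    J i = [ fromℕ (l i) , fromℕ (l i ⊔ r i) ]⟨ fromℕ-mono (ℕ.m≤m⊔n (l i) (r i)) ⟩
    to : ∀ {i j} → i ≢ j → Graph._~_ endpointsGraph i j → points (J i) ≬ points (J j)
    to {i} {j} i≢j (_ , p , q) = fromℕ (l i ⊔ l j) ,
      (fromℕ-mono (ℕ.m≤m⊔n (l i) (l j)) , fromℕ-mono (ℕ.⊔-lub (ℕ.m≤m⊔n (l i) (r i)) q)) ,
      (fromℕ-mono (ℕ.m≤n⊔m (l i) (l j)) , fromℕ-mono (ℕ.⊔-lub p (ℕ.m≤m⊔n (l j) (r j))))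
    from : ∀ {i j} → i ≢ j → points (J i) ≬ points (J j) → Graph._~_ endpointsGraph i j
    from i≢j (x , (a≤x , x≤b) , (c≤x , x≤d)) = i≢j ,
      fromℕ-cancel (≤-trans a≤x x≤d) , fromℕ-cancel (≤-trans c≤x x≤b)

¬¬-∀ : ∀ {n} {P : Fin n → Set} → (∀ i → ¬ ¬ P i) → ¬ ¬ (∀ i → P i)
¬¬-∀ {zero}      h k = k λ ()
¬¬-∀ {suc n} {P} h k = h zero λ p → ¬¬-∀ (h ∘ suc) λ ps → k λ { zero → p ; (suc i) → ps i }

argbest : (_R_ : ℕ → ℕ → Set) → (∀ {a} → a R a) → (∀ {a b c} → a R b → b R c → a R c) → (∀ a b → a R b ⊎ b R a) →
  ∀ {n} → Fin n → (f : Fin n → ℕ) → ∃[ i ] ∀ j → f i R f j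
argbest _R_ rfl trs tot {suc zero}    _ f = zero , λ { zero → rfl }
argbest _R_ rfl trs tot {suc (suc n)} _ f with argbest _R_ rfl trs tot zero (f ∘ suc)
... | i , best with tot (f zero) (f (suc i))
...   | inj₁ h = zero  , λ { zero → rfl ; (suc j) → trs h (best j) }
...   | inj₂ h = suc i , λ { zero → h   ; (suc j) → best j }

module Rank {K} (p : Fin K → ℝ) (_≤?_ : ∀ a b → Dec (p a ≤ p b)) where

  ≰⇒≥ : ∀ {a b} → ¬ (p a ≤ p b) → p b ≤ p a
  ≰⇒≥ {a} {b} h = ≮⇒≥ λ lt → h (<⇒≤ lt)

  below : Fin K → Subset K
  below a = tabulate (λ b → does (¬? (a ≤? b)))

  ∈below : ∀ {a b} → ¬ (p a ≤ p b) → b Subset.∈ below a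
  ∈below {a} {b} h = lookup⇒[]= b (below a) (trans (lookup∘tabulate _ b) (dec-true (¬? (a ≤? b)) h))

  ∈below⁻ : ∀ {a b} → b Subset.∈ below a → ¬ (p a ≤ p b)
  ∈below⁻ {a} {b} h with a ≤? b | trans (sym (lookup∘tabulate (λ b → does (¬? (a ≤? b))) b)) ([]=⇒lookup h)
  ... | no  a≰b | _  = a≰b
  ... | yes _   | ()

  rank : Fin K → Fin (suc K)
  rank a = fromℕ< {Subset.∣ below a ∣} (s≤s (Subset.∣p∣≤n (below a)))

  toℕ-rank : ∀ a → toℕ (rank a) ≡ Subset.∣ below a ∣
  toℕ-rank a = Fin.toℕ-fromℕ< _

  below-⊆ : ∀ {a b} → p a ≤ p b → below a Subset.⊆ below b
  below-⊆ {a} {b} a≤b {x} x∈ = ∈below λ b≤x → ∈below⁻ x∈ (≤-trans a≤b b≤x)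

  rank-mono : ∀ {a b} → p a ≤ p b → toℕ (rank a) ℕ.≤ toℕ (rank b)
  rank-mono {a} {b} a≤b = subst₂ ℕ._≤_ (sym (toℕ-rank a)) (sym (toℕ-rank b)) (Subset.p⊆q⇒∣p∣≤∣q∣ (below-⊆ a≤b))

  rank-cancel : ∀ {a b} → toℕ (rank a) ℕ.≤ toℕ (rank b) → p a ≤ p b
  rank-cancel {a} {b} h with a ≤? b
  ... | yes a≤b = a≤b
  ... | no  a≰b = contradiction
    (Subset.p⊂q⇒∣p∣<∣q∣ (below-⊆ (≰⇒≥ a≰b) , b , ∈below a≰b , λ b∈ → ∈below⁻ b∈ (≤-refl (p b))))
    (ℕ.≤⇒≯ (subst₂ ℕ._≤_ (toℕ-rank a) (toℕ-rank b) h))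

-- Being an interval graph is decidable: classically only the relative order of
-- finitely many points of the intervals matters, so that natural endpoints
-- bounded in terms of n suffice, and a search over those is ¬¬-stable.
module Compress {n} (G : Graph n) (J : Fin n → Interval) (GJ : IsIntersectionGraph G J) where
  open Graph G

  own : ∀ i → ∃ (_∈ points (J i))
  own i = inhabited (J i)

  meet : ∀ {i j} → i ~ j → points (J i) ≬ points (J j)
  meet e = Equivalence.to (GJ (λ i≡j → ~-irrefl i≡j e)) e

  w : Fin n → Fin n → ℝ
  w i j with i ~? j
  ... | yes e = proj₁ (meet e)
  ... | no _  = proj₁ (own i)

  w∈ : ∀ {i j} → i ~ j → w i j ∈ points (J i) × w i j ∈ points (J j)
  w∈ {i} {j} e with i ~? j
  ... | yes e′ = proj₂ (meet e′)
  ... | no ¬e  = contradiction e ¬e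

  pick : Fin n → Fin n → ℝ
  pick i j with i Fin.≤? j
  ... | yes _ = w i j
  ... | no _  = w j i

  pick∈ : ∀ {i j} → i ~ j → pick i j ∈ points (J i)
  pick∈ {i} {j} e with i Fin.≤? j
  ... | yes _ = proj₁ (w∈ e)
  ... | no _  = proj₂ (w∈ (~-sym e))

  pick-sym : ∀ i j → pick i j ≡ pick j i
  pick-sym i j with i Fin.≤? j | j Fin.≤? i
  ... | yes i≤j | yes j≤i = cong₂ w (Fin.≤-antisym i≤j j≤i) (Fin.≤-antisym j≤i i≤j)
  ... | yes _   | no _    = refl
  ... | no _    | yes _   = refl
  ... | no i≰j  | no j≰i  = contradiction (ℕ.<⇒≤ (ℕ.≰⇒> i≰j)) j≰i

  p : Fin n → Fin n → ℝ
  p i j with i ~? j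
  ... | yes _ = pick i j
  ... | no _  = proj₁ (own i)

  p∈ : ∀ i j → p i j ∈ points (J i)
  p∈ i j with i ~? j
  ... | yes e = pick∈ e
  ... | no _  = proj₂ (own i)

  p-sym : ∀ {i j} → i ~ j → p i j ≡ p j i
  p-sym {i} {j} e with i ~? j | j ~? i
  ... | yes _ | yes _ = pick-sym i j
  ... | no ¬e | _     = contradiction e ¬e
  ... | yes _ | no ¬e = contradiction (~-sym e) ¬e

  M : ℕ
  M = suc (n ℕ.* n)

  Agrees : (l r : Fin n → ℕ) → Set
  Agrees l r = ∀ i j → (i H.~ j → i ~ j) × (i ~ j → i H.~ j)
    where module H = Graph (endpointsGraph l r)

  agrees? : ∀ l r → Dec (Agrees l r)
  agrees? l r = Fin.all? λ i → Fin.all? λ j →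
    ((i H.~? j) →-dec (i ~? j)) ×-dec ((i ~? j) →-dec (i H.~? j))
    where module H = Graph (endpointsGraph l r)

  module Ranked (_≤?_ : ∀ a b → Dec (uncurry p (remQuot {n} n a) ≤ uncurry p (remQuot {n} n b))) where
    open Rank (uncurry p ∘ remQuot {n} n) _≤?_

    r : Fin n → Fin n → Fin M
    r i j = rank (combine i j)

    r-mono : ∀ {i j k l} → p i j ≤ p k l → toℕ (r i j) ℕ.≤ toℕ (r k l)
    r-mono {i} {j} {k} {l} h = rank-mono (subst₂ (λ u v → uncurry p u ≤ uncurry p v)
      (sym (Fin.remQuot-combine i j)) (sym (Fin.remQuot-combine k l)) h)

    r-cancel : ∀ {i j k l} → toℕ (r i j) ℕ.≤ toℕ (r k l) → p i j ≤ p k l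
    r-cancel {i} {j} {k} {l} h = subst₂ (λ u v → uncurry p u ≤ uncurry p v)
      (Fin.remQuot-combine i j) (Fin.remQuot-combine k l) (rank-cancel h)

    least : ∀ i → ∃[ j ] ∀ k → toℕ (r i j) ℕ.≤ toℕ (r i k)
    least i = argbest ℕ._≤_ ℕ.≤-refl ℕ.≤-trans ℕ.≤-total i (toℕ ∘ r i)

    greatest : ∀ i → ∃[ j ] ∀ k → toℕ (r i k) ℕ.≤ toℕ (r i j)
    greatest i = argbest ℕ._≥_ ℕ.≤-refl (λ h g → ℕ.≤-trans g h) (λ a b → ℕ.≤-total b a) i (toℕ ∘ r i)

    lo hi : Fin n → Fin M
    lo i = r i (proj₁ (least i))
    hi i = r i (proj₁ (greatest i))

    lo≤hi : ∀ i → toℕ (lo i) ℕ.≤ toℕ (hi i)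
    lo≤hi i = proj₂ (least i) _

    lo≤hi′ : ∀ {i j} → i ~ j → toℕ (lo i) ℕ.≤ toℕ (hi j)
    lo≤hi′ {i} {j} e = ℕ.≤-trans (proj₂ (least i) j) (ℕ.≤-trans
      (r-mono (subst (p i j ≤_) (p-sym e) (≤-refl (p i j)))) (proj₂ (greatest j) i))

    agrees : Agrees (toℕ ∘ lo) (toℕ ∘ hi)
    agrees i j = to , from
      where
      a = proj₁ (least i)
      b = proj₁ (greatest j)
      c = proj₁ (least j)
      d = proj₁ (greatest i)
      to : Graph._~_ (endpointsGraph (toℕ ∘ lo) (toℕ ∘ hi)) i j → i ~ j
      to (i≢j , h , g) = Equivalence.from (GJ i≢j) (common (ℕ.≤-total (toℕ (r i a)) (toℕ (r j c))))
        where
        i≤j : p i a ≤ p j b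
        i≤j = r-cancel (ℕ.≤-trans h (ℕ.≤-reflexive (ℕ.m≤n⇒m⊔n≡n (lo≤hi j))))
        j≤i : p j c ≤ p i d
        j≤i = r-cancel (ℕ.≤-trans g (ℕ.≤-reflexive (ℕ.m≤n⇒m⊔n≡n (lo≤hi i))))
        common : toℕ (r i a) ℕ.≤ toℕ (r j c) ⊎ toℕ (r j c) ℕ.≤ toℕ (r i a) → points (J i) ≬ points (J j)
        common (inj₁ a≤c) = p j c , convex (J i) (p∈ i a) (p∈ i d) (r-cancel a≤c) j≤i , p∈ j c
        common (inj₂ c≤a) = p i a , p∈ i a , convex (J j) (p∈ j c) (p∈ j b) (r-cancel c≤a) i≤j
      from : i ~ j → Graph._~_ (endpointsGraph (toℕ ∘ lo) (toℕ ∘ hi)) i j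
      from e = (λ i≡j → ~-irrefl i≡j e) ,
        ℕ.≤-trans (lo≤hi′ e) (ℕ.m≤n⊔m _ _) , ℕ.≤-trans (lo≤hi′ (~-sym e)) (ℕ.m≤n⊔m _ _)

  decode : Fin (M ^ n) → Fin n → ℕ
  decode c i = toℕ (finToFun {M} c i)

  Agrees-resp : ∀ {l l′ r r′} → (∀ i → l i ≡ l′ i) → (∀ i → r i ≡ r′ i) → Agrees l r → Agrees l′ r′
  Agrees-resp l≗ r≗ h i j rewrite sym (l≗ i) | sym (l≗ j) | sym (r≗ i) | sym (r≗ j) = h i j

  encoded : ∃[ c ] ∃[ d ] Agrees (decode c) (decode d)
  encoded = decidable-stable (Fin.any? λ c → Fin.any? λ d → agrees? (decode c) (decode d)) λ none →
    ¬¬-∀ (λ a → ¬¬-∀ (λ b → ¬¬-excluded-middle)) λ _≤?_ → let open Ranked _≤?_ in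
      none (funToFin lo , funToFin hi , Agrees-resp
        (λ i → cong toℕ (sym (Fin.finToFun-funToFin lo i)))
        (λ i → cong toℕ (sym (Fin.finToFun-funToFin hi i))) agrees)

module _ (n : ℕ) where
  private
    M : ℕ
    M = suc (n ℕ.* n)

    decode : Fin (M ^ n) → Fin n → ℕ
    decode c i = toℕ (finToFun {M} c i)

    model : Fin (M ^ n) × Fin (M ^ n) → IntervalGraph n
    model (c , d) = endpointsGraph (decode c) (decode d) , endpointsGraph-isIntervalGraph (decode c) (decode d)

  finitelyMany : ∃[ m ] Bijection (≡.setoid (Fin m)) (intervalGraphs n)
  finitelyMany = finite (intervalGraphs n) (λ G H → ≅-dec (proj₁ G) (proj₁ H)) (M ^ n ℕ.* M ^ n)
    (model ∘ remQuot (M ^ n)) λ (G , J , GJ) → let c , d , h = Compress.encoded G J GJ in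
      combine c d , subst (λ cd → proj₁ (model cd) ≅ G) (sym (Fin.remQuot-combine c d))
        (Perm.id , λ i j → mk⇔ (proj₁ (h i j)) (proj₂ (h i j)))

-- The number of isomorphism classes of interval graphs on n vertices.
I : ℕ → ℕ
I n = proj₁ (finitelyMany n)

{-# OPTIONS --safe #-}

-- Take 2h points 0, …, 2h - 1 and m intervals, each from one of the first h points
-- to one of the last h. Adjacency to the points determines an interval, so there are
-- h^{2m} different labelled graphs on n = 2h + m vertices, and each isomorphism class
-- contains at most n^n labelled graphs: h^{2m} ≤ I_n n^n. With h ≈ n/ℓ, where
-- ℓ ≈ log₂ n, this becomes n^n ≤ I_n (8ℓ)^{2n}, and the claim follows on taking
-- logarithms, since ℓ = O(log n).
-- The functional equation of log comes from Riemann sums: with step 1/N, that of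
-- ∫₁^a dt/t is the harmonic sum of 1/i over N ≤ i < aN. The sum for ab with step 1/N is
-- exactly the sum for a with step 1/N plus the sum for b with step 1/(aN).
module Submission where

open import Defs
open import Data.Nat as ℕ using (ℕ; zero; suc; _⊔_; _^_; z≤n; s≤s; NonZero)
import Data.Nat.Properties as ℕ
import Data.Nat.DivMod as ℕ
open import Data.Nat.Tactic.RingSolver using (solve-∀)
open import Data.Rational as ℚ using (ℚ; 0ℚ; 1ℚ; ½; ∣_∣)
import Data.Rational.Properties as ℚ
open import Data.Rational.Solver using (module +-*-Solver)
open import Data.Fin as Fin using (Fin; zero; suc; toℕ; _↑ˡ_; _↑ʳ_; splitAt; combine; remQuot; finToFun; funToFin)
import Data.Fin.Properties as Fin
open import Data.Fin.Permutation using (_⟨$⟩ʳ_)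
open import Data.Product using (Σ-syntax; ∃-syntax; _×_; _,_; proj₁; proj₂)
open import Data.Sum using (inj₁; inj₂; [_,_]′)
open import Function using (_∘_; Equivalence; Bijection)
open import Relation.Binary.PropositionalEquality
  using (_≡_; _≢_; refl; sym; trans; cong; cong₂; subst; subst₂; module ≡-Reasoning)
open import Relation.Nullary using (yes; no; contradiction)

open +-*-Solver using (solve; _:=_; _:+_; _:*_; _:-_; con)

-- Labelled graphs in an isomorphism class

-- A labelled graph is recovered from its class and the vertex map of an isomorphism onto the
-- representative of that class, and there are `n ^ n` vertex maps. So the pair (class, map) is an
-- injective code.
labelled≤ : ∀ {n K} (F : Fin K → IntervalGraph n) →
  (∀ c d → (∀ i j → Graph._~_ (proj₁ (F c)) i j → Graph._~_ (proj₁ (F d)) i j) →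
           (∀ i j → Graph._~_ (proj₁ (F d)) i j → Graph._~_ (proj₁ (F c)) i j) → c ≡ d) →
  K ℕ.≤ I n ℕ.* n ^ n
labelled≤ {n} F distinct = Fin.injective⇒≤ {f = code} code-injective
  where
  open Bijection (proj₂ (finitelyMany n)) using (to; strictlySurjective)
  class : ∀ c → Fin (I n)
  class c = proj₁ (strictlySurjective (F c))
  iso : ∀ c → proj₁ (F c) ≅ proj₁ (to (class c))
  iso c = ≅-sym (proj₁ (to (class c))) (proj₁ (F c)) (proj₂ (strictlySurjective (F c)))
  π : ∀ c → Fin n → Fin n
  π c i = proj₁ (iso c) ⟨$⟩ʳ i
  code : ∀ c → Fin (I n ℕ.* n ^ n)
  code c = combine (class c) (funToFin (π c))
  transport : ∀ {c d} → class c ≡ class d → (∀ i → π c i ≡ π d i) → ∀ i j →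
    Graph._~_ (proj₁ (F c)) i j → Graph._~_ (proj₁ (F d)) i j
  transport {c} {d} classes πs i j e = Equivalence.from (proj₂ (iso d) i j)
    (subst₂ (Graph._~_ (proj₁ (to (class d)))) (πs i) (πs j)
      (subst (λ b → Graph._~_ (proj₁ (to b)) (π c i) (π c j)) classes (Equivalence.to (proj₂ (iso c) i j) e)))
  code-injective : ∀ {c d} → code c ≡ code d → c ≡ d
  code-injective {c} {d} e = distinct c d
    (transport classes πs) (transport (sym classes) (sym ∘ πs))
    where
    both = Fin.combine-injective (class c) (funToFin (π c)) (class d) (funToFin (π d)) e
    classes = proj₁ both
    πs : ∀ i → π c i ≡ π d i
    πs i = trans (sym (Fin.finToFun-funToFin (π c) i))
      (trans (cong (λ f → finToFun f i) (proj₂ both)) (Fin.finToFun-funToFin (π d) i))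

-- Labelled graphs from intervals over fixed points

-- Vertex i < 2h is the point i, and vertex 2h + j is the interval [a j, h + b j].
-- Its ends are the first and the last of the points that it meets.
module Intervals (h m : ℕ) where

  n : ℕ
  n = (h ℕ.+ h) ℕ.+ m

  point : Fin (h ℕ.+ h) → Fin n
  point i = i ↑ˡ m

  interval : Fin m → Fin n
  interval j = (h ℕ.+ h) ↑ʳ j

  point≢interval : ∀ i j → point i ≢ interval j
  point≢interval i j e = inj₁≢inj₂ (trans (sym (Fin.splitAt-↑ˡ (h ℕ.+ h) i m))
    (trans (cong (splitAt (h ℕ.+ h)) e) (Fin.splitAt-↑ʳ (h ℕ.+ h) m j)))
    where
    inj₁≢inj₂ : inj₁ i ≢ inj₂ j
    inj₁≢inj₂ ()

  module _ (a b : Fin m → Fin h) where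

    left right : Fin n → ℕ
    left  v = [ toℕ , toℕ ∘ a ]′ (splitAt (h ℕ.+ h) v)
    right v = [ toℕ , (λ j → h ℕ.+ toℕ (b j)) ]′ (splitAt (h ℕ.+ h) v)

    graph : IntervalGraph n
    graph = endpointsGraph left right , endpointsGraph-isIntervalGraph left right

    left-point : ∀ i → left (point i) ≡ toℕ i
    left-point i rewrite Fin.splitAt-↑ˡ (h ℕ.+ h) i m = refl

    right-point : ∀ i → right (point i) ≡ toℕ i
    right-point i rewrite Fin.splitAt-↑ˡ (h ℕ.+ h) i m = refl

    left-interval : ∀ j → left (interval j) ≡ toℕ (a j)
    left-interval j rewrite Fin.splitAt-↑ʳ (h ℕ.+ h) m j = refl

    right-interval : ∀ j → right (interval j) ≡ h ℕ.+ toℕ (b j)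
    right-interval j rewrite Fin.splitAt-↑ʳ (h ℕ.+ h) m j = refl

    -- Left ends lie below `h` and right ends do not, so every choice of `a` and `b` gives genuine
    -- intervals and the `⊔` in `endpointsGraph` leaves the right end as it is.
    a≤h+b : ∀ j → toℕ (a j) ℕ.≤ h ℕ.+ toℕ (b j)
    a≤h+b j = ℕ.≤-trans (ℕ.<⇒≤ (Fin.toℕ<n (a j))) (ℕ.m≤m+n h _)

    end-interval : ∀ j → left (interval j) ⊔ right (interval j) ≡ h ℕ.+ toℕ (b j)
    end-interval j = trans (cong₂ _⊔_ (left-interval j) (right-interval j)) (ℕ.m≤n⇒m⊔n≡n (a≤h+b j))

    end-point : ∀ i → left (point i) ⊔ right (point i) ≡ toℕ i
    end-point i = trans (cong₂ _⊔_ (left-point i) (right-point i)) (ℕ.⊔-idem (toℕ i))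

    open Graph (proj₁ graph)

    meets : ∀ i j → toℕ (a j) ℕ.≤ toℕ i → toℕ i ℕ.≤ h ℕ.+ toℕ (b j) → point i ~ interval j
    meets i j a≤i i≤b = point≢interval i j ,
      subst₂ ℕ._≤_ (sym (left-point i)) (sym (end-interval j)) i≤b ,
      subst₂ ℕ._≤_ (sym (left-interval j)) (sym (end-point i)) a≤i

    meets⁻ : ∀ i j → point i ~ interval j → toℕ (a j) ℕ.≤ toℕ i × toℕ i ℕ.≤ h ℕ.+ toℕ (b j)
    meets⁻ i j (_ , i≤b , a≤i) =
      subst₂ ℕ._≤_ (left-interval j) (end-point i) a≤i ,
      subst₂ ℕ._≤_ (left-point i) (end-interval j) i≤b

  _⊑_ : (G H : IntervalGraph n) → Set
  G ⊑ H = ∀ i j → Graph._~_ (proj₁ G) i j → Graph._~_ (proj₁ H) i j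

  -- The test vertex is the point at `a j`: interval `j` of the first graph contains it, hence so
  -- does interval `j` of the second.
  left-antitone : ∀ a b a′ b′ → graph a b ⊑ graph a′ b′ → ∀ j → toℕ (a′ j) ℕ.≤ toℕ (a j)
  left-antitone a b a′ b′ sub j = subst (toℕ (a′ j) ℕ.≤_) (Fin.toℕ-↑ˡ (a j) h)
    (proj₁ (meets⁻ a′ b′ i j (sub _ _ (meets a b i j
      (ℕ.≤-reflexive (sym (Fin.toℕ-↑ˡ (a j) h)))
      (subst (ℕ._≤ h ℕ.+ toℕ (b j)) (sym (Fin.toℕ-↑ˡ (a j) h)) (a≤h+b a b j))))))
    where i = a j ↑ˡ h

  -- The same test with the point at `h + b j`.
  right-monotone : ∀ a b a′ b′ → graph a b ⊑ graph a′ b′ → ∀ j → toℕ (b j) ℕ.≤ toℕ (b′ j)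
  right-monotone a b a′ b′ sub j = ℕ.+-cancelˡ-≤ h _ _ (subst (ℕ._≤ h ℕ.+ toℕ (b′ j)) (Fin.toℕ-↑ʳ h (b j))
    (proj₂ (meets⁻ a′ b′ i j (sub _ _ (meets a b i j
      (subst (toℕ (a j) ℕ.≤_) (sym (Fin.toℕ-↑ʳ h (b j))) (a≤h+b a b j))
      (ℕ.≤-reflexive (Fin.toℕ-↑ʳ h (b j))))))))
    where i = h ↑ʳ b j

  -- The `j`-th of the `m` digits of `c` in base `h * h`, split into two digits in base `h`.
  ends : Fin ((h ℕ.* h) ^ m) → Fin m → Fin h × Fin h
  ends c j = remQuot h (finToFun c j)

  ends-injective : ∀ c d → (∀ j → ends c j ≡ ends d j) → c ≡ d
  ends-injective c d eq = trans (sym (Fin.funToFin-finToFin {m = m} {n = h ℕ.* h} c))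
    (trans (funToFin-cong (λ j → trans (sym (Fin.combine-remQuot {h} h (finToFun c j)))
      (trans (cong (λ (x , y) → combine x y) (eq j)) (Fin.combine-remQuot {h} h (finToFun d j)))))
      (Fin.funToFin-finToFin {m = m} {n = h ℕ.* h} d))
    where
    funToFin-cong : ∀ {k l} {f g : Fin k → Fin l} → (∀ i → f i ≡ g i) → funToFin f ≡ funToFin g
    funToFin-cong {zero}  h = refl
    funToFin-cong {suc k} h = cong₂ combine (h zero) (funToFin-cong (h ∘ suc))

  encoded : Fin ((h ℕ.* h) ^ m) → IntervalGraph n
  encoded c = graph (proj₁ ∘ ends c) (proj₂ ∘ ends c)

  encoded-injective : ∀ c d → encoded c ⊑ encoded d → encoded d ⊑ encoded c → c ≡ d
  encoded-injective c d c⊑d d⊑c = ends-injective c d λ j → cong₂ _,_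
    (Fin.toℕ-injective (ℕ.≤-antisym (left-antitone ad bd ac bc d⊑c j) (left-antitone ac bc ad bd c⊑d j)))
    (Fin.toℕ-injective (ℕ.≤-antisym (right-monotone ac bc ad bd c⊑d j) (right-monotone ad bd ac bc d⊑c j)))
    where
    ac = proj₁ ∘ ends c
    bc = proj₂ ∘ ends c
    ad = proj₁ ∘ ends d
    bd = proj₂ ∘ ends d

  count : (h ℕ.* h) ^ m ℕ.≤ I n ℕ.* n ^ n
  count = labelled≤ {n} {(h ℕ.* h) ^ m} encoded encoded-injective

-- From the count to a bound on n^n

^-distribʳ-* : ∀ k m n → (m ℕ.* n) ^ k ≡ m ^ k ℕ.* n ^ k
^-distribʳ-* zero    m n = refl
^-distribʳ-* (suc k) m n = trans (cong (m ℕ.* n ℕ.*_) (^-distribʳ-* k m n)) (eq m n (m ^ k) (n ^ k))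
  where
  eq : ∀ m n x y → m ℕ.* n ℕ.* (x ℕ.* y) ≡ m ℕ.* x ℕ.* (n ℕ.* y)
  eq = solve-∀

n<2^n : ∀ n → n ℕ.< 2 ^ n
n<2^n zero    = s≤s z≤n
n<2^n (suc n) = ℕ.≤-trans (s≤s (n<2^n n))
  (ℕ.≤-trans (ℕ.+-monoˡ-≤ (2 ^ n) (ℕ.m^n>0 2 n)) (ℕ.+-monoʳ-≤ (2 ^ n) (ℕ.≤-reflexive (sym (ℕ.+-identityʳ (2 ^ n))))))

binary-log : ∀ n → 1 ℕ.≤ n → ∃[ p ] 2 ^ p ℕ.≤ n × n ℕ.< 2 ^ suc p
binary-log (suc zero)    _ = 0 , s≤s z≤n , s≤s (s≤s z≤n)
binary-log (suc (suc n)) _ with binary-log (suc n) (s≤s z≤n)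
... | p , lo , hi with suc (suc n) ℕ.<? 2 ^ suc p
...   | yes lt = p , ℕ.m≤n⇒m≤1+n lo , lt
...   | no ¬lt = suc p , ℕ.≮⇒≥ ¬lt , ℕ.≤-<-trans hi (ℕ.^-monoʳ-< 2 (s≤s (s≤s z≤n)) (ℕ.n<1+n (suc p)))

-- Here h = ⌊n/ℓ⌋: the points cost only a factor n^{4h} ≤ 2^{4hℓ} ≤ 4^{2n}.
count-log : ∀ i n ℓ .{{_ : NonZero ℓ}} → (∀ h m → h ℕ.+ h ℕ.+ m ≡ n → (h ℕ.* h) ^ m ℕ.≤ i ℕ.* n ^ n) →
  2 ℕ.≤ ℓ → ℓ ℕ.≤ n → n ℕ.≤ 2 ^ ℓ → n ^ n ℕ.≤ i ℕ.* (8 ℕ.* ℓ) ^ (2 ℕ.* n)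
count-log i n ℓ many 2≤ℓ ℓ≤n n≤2^ℓ =
  -- The count bounds `(h * h) ^ m` by `i * n ^ n`, so the inequality is proved with an extra factor
  -- `n ^ n` on both sides.
  ℕ.*-cancelʳ-≤ (n ^ n) (i ℕ.* (8 ℕ.* ℓ) ^ (2 ℕ.* n)) (n ^ n) {{ℕ.m^n≢0 n n {{ℕ.>-nonZero 0<n}}}} (begin
    n ^ n ℕ.* n ^ n
      ≡⟨ sym (ℕ.^-distribˡ-+-* n n n) ⟩
    n ^ (n ℕ.+ n)
      ≡⟨ cong (n ^_) (trans (cong₂ ℕ._+_ (sym n≡) (sym n≡)) (exps h m)) ⟩
    n ^ (2 ℕ.* m ℕ.+ 4 ℕ.* h)
      ≡⟨ ℕ.^-distribˡ-+-* n (2 ℕ.* m) (4 ℕ.* h) ⟩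
    n ^ (2 ℕ.* m) ℕ.* n ^ (4 ℕ.* h)
      -- The exponent 2n is 2m + 4h. The 2m factors of the intervals use n ≤ 2hℓ, the 4h factors of
      -- the points use n ≤ 2^ℓ.
      ≤⟨ ℕ.*-mono-≤ (ℕ.^-monoˡ-≤ (2 ℕ.* m) n≤h*2ℓ) (ℕ.^-monoˡ-≤ (4 ℕ.* h) n≤2^ℓ) ⟩
    (h ℕ.* (2 ℕ.* ℓ)) ^ (2 ℕ.* m) ℕ.* (2 ^ ℓ) ^ (4 ℕ.* h)
      ≡⟨ cong₂ ℕ._*_ split (ℕ.^-*-assoc 2 ℓ (4 ℕ.* h)) ⟩
    (h ℕ.* h) ^ m ℕ.* (2 ℕ.* ℓ) ^ (2 ℕ.* m) ℕ.* 2 ^ (ℓ ℕ.* (4 ℕ.* h))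
      ≤⟨ ℕ.*-mono-≤ (ℕ.*-mono-≤ counted (ℕ.^-monoʳ-≤ (2 ℕ.* ℓ) (ℕ.*-monoʳ-≤ 2 m≤n))) (ℕ.^-monoʳ-≤ 2 ℓ4h≤4n) ⟩
    i ℕ.* n ^ n ℕ.* (2 ℕ.* ℓ) ^ (2 ℕ.* n) ℕ.* 2 ^ (2 ℕ.* (2 ℕ.* n))
      ≡⟨ cong (i ℕ.* n ^ n ℕ.* (2 ℕ.* ℓ) ^ (2 ℕ.* n) ℕ.*_) (sym (ℕ.^-*-assoc 2 2 (2 ℕ.* n))) ⟩
    i ℕ.* n ^ n ℕ.* (2 ℕ.* ℓ) ^ (2 ℕ.* n) ℕ.* 4 ^ (2 ℕ.* n)
      ≡⟨ shuffle (i) (n ^ n) ((2 ℕ.* ℓ) ^ (2 ℕ.* n)) (4 ^ (2 ℕ.* n)) ⟩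
    i ℕ.* (4 ^ (2 ℕ.* n) ℕ.* (2 ℕ.* ℓ) ^ (2 ℕ.* n)) ℕ.* n ^ n
      ≡⟨ cong (λ x → i ℕ.* x ℕ.* n ^ n) (trans (sym (^-distribʳ-* (2 ℕ.* n) 4 (2 ℕ.* ℓ))) (cong (_^ (2 ℕ.* n)) (sym (ℕ.*-assoc 4 2 ℓ)))) ⟩
    i ℕ.* (8 ℕ.* ℓ) ^ (2 ℕ.* n) ℕ.* n ^ n ∎)
  where
  open ℕ.≤-Reasoning
  instance
    2ℓ≢0 : NonZero (2 ℕ.* ℓ)
    2ℓ≢0 = ℕ.m*n≢0 2 ℓ
  h = n ℕ./ ℓ
  m = n ℕ.∸ (h ℕ.+ h)
  0<n : 0 ℕ.< n
  0<n = ℕ.≤-trans (ℕ.≤-trans (s≤s z≤n) 2≤ℓ) ℓ≤n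
  hℓ≤n : h ℕ.* ℓ ℕ.≤ n
  hℓ≤n = ℕ.m/n*n≤m n ℓ
  2h≤n : h ℕ.+ h ℕ.≤ n
  2h≤n = ℕ.≤-trans (ℕ.≤-trans (ℕ.≤-reflexive (double h)) (ℕ.*-monoʳ-≤ h 2≤ℓ)) hℓ≤n
    where
    double : ∀ h → h ℕ.+ h ≡ h ℕ.* 2
    double = solve-∀
  n≡ : h ℕ.+ h ℕ.+ m ≡ n
  n≡ = ℕ.m+[n∸m]≡n 2h≤n
  m≤n : m ℕ.≤ n
  m≤n = ℕ.m∸n≤m n (h ℕ.+ h)
  1≤h : 1 ℕ.≤ h
  1≤h = ℕ.m≥n⇒m/n>0 ℓ≤n
  -- The remainder of the division is below ℓ, and ℓ ≤ hℓ because h ≥ 1.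
  n≤h*2ℓ : n ℕ.≤ h ℕ.* (2 ℕ.* ℓ)
  n≤h*2ℓ = begin
    n                                ≡⟨ ℕ.m≡m%n+[m/n]*n n ℓ ⟩
    n ℕ.% ℓ ℕ.+ h ℕ.* ℓ              ≤⟨ ℕ.+-monoˡ-≤ (h ℕ.* ℓ) (ℕ.<⇒≤ (ℕ.m%n<n n ℓ)) ⟩
    ℓ ℕ.+ h ℕ.* ℓ                    ≤⟨ ℕ.+-monoˡ-≤ (h ℕ.* ℓ) (ℕ.≤-trans (ℕ.≤-reflexive (sym (ℕ.*-identityˡ ℓ))) (ℕ.*-monoˡ-≤ ℓ 1≤h)) ⟩
    h ℕ.* ℓ ℕ.+ h ℕ.* ℓ              ≡⟨ twice h ℓ ⟩
    h ℕ.* (2 ℕ.* ℓ)                  ∎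
    where
    twice : ∀ h l → h ℕ.* l ℕ.+ h ℕ.* l ≡ h ℕ.* (2 ℕ.* l)
    twice = solve-∀
  exps : ∀ h m → (h ℕ.+ h ℕ.+ m) ℕ.+ (h ℕ.+ h ℕ.+ m) ≡ 2 ℕ.* m ℕ.+ 4 ℕ.* h
  exps = solve-∀
  ℓ4h≤4n : ℓ ℕ.* (4 ℕ.* h) ℕ.≤ 2 ℕ.* (2 ℕ.* n)
  ℓ4h≤4n = ℕ.≤-trans (ℕ.≤-reflexive (eq ℓ h)) (ℕ.*-monoʳ-≤ 2 (ℕ.*-monoʳ-≤ 2 hℓ≤n))
    where
    eq : ∀ l h → l ℕ.* (4 ℕ.* h) ≡ 2 ℕ.* (2 ℕ.* (h ℕ.* l))
    eq = solve-∀
  split : (h ℕ.* (2 ℕ.* ℓ)) ^ (2 ℕ.* m) ≡ (h ℕ.* h) ^ m ℕ.* (2 ℕ.* ℓ) ^ (2 ℕ.* m)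
  split = trans (^-distribʳ-* (2 ℕ.* m) h (2 ℕ.* ℓ)) (cong (ℕ._* (2 ℕ.* ℓ) ^ (2 ℕ.* m))
    (trans (sym (ℕ.^-*-assoc h 2 m)) (cong (λ x → (h ℕ.* x) ^ m) (ℕ.*-identityʳ h))))
  counted : (h ℕ.* h) ^ m ℕ.≤ i ℕ.* n ^ n
  counted = many h m n≡
  shuffle : ∀ i x y z → i ℕ.* x ℕ.* y ℕ.* z ≡ i ℕ.* (z ℕ.* y) ℕ.* x
  shuffle = solve-∀

I-bound : ∀ n ℓ .{{_ : NonZero ℓ}} → 2 ℕ.≤ ℓ → ℓ ℕ.≤ n → n ℕ.≤ 2 ^ ℓ → n ^ n ℕ.≤ I n ℕ.* (8 ℕ.* ℓ) ^ (2 ℕ.* n)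
I-bound n ℓ = count-log (I n) n ℓ many
  where
  many : ∀ h m → h ℕ.+ h ℕ.+ m ≡ n → (h ℕ.* h) ^ m ℕ.≤ I n ℕ.* n ^ n
  many h m refl = Intervals.count h m

-- Riemann sums and harmonic sums

p≤p+q : ∀ p {q} → 0ℚ ℚ.≤ q → p ℚ.≤ p ℚ.+ q
p≤p+q p {q} 0≤q = subst (ℚ._≤ p ℚ.+ q) (ℚ.+-identityʳ p) (ℚ.+-monoʳ-≤ p 0≤q)

∑-cong-< : ∀ n {f g : ℕ → ℚ} → (∀ i → i ℕ.< n → f i ≡ g i) → ∑ n f ≡ ∑ n g
∑-cong-< zero    h = refl
∑-cong-< (suc n) h = cong₂ ℚ._+_ (∑-cong-< n λ i i<n → h i (ℕ.m≤n⇒m≤1+n i<n)) (h n ℕ.≤-refl)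

∑-mono-< : ∀ n {f g : ℕ → ℚ} → (∀ i → i ℕ.< n → f i ℚ.≤ g i) → ∑ n f ℚ.≤ ∑ n g
∑-mono-< zero    h = ℚ.≤-refl
∑-mono-< (suc n) h = ℚ.+-mono-≤ (∑-mono-< n λ i i<n → h i (ℕ.m≤n⇒m≤1+n i<n)) (h n ℕ.≤-refl)

÷⁺-mono : ∀ x x′ d d′ d>0 d′>0 → x ℚ.* d′ ℚ.≤ x′ ℚ.* d → x ÷⁺ d ∵ d>0 ℚ.≤ x′ ÷⁺ d′ ∵ d′>0
÷⁺-mono x x′ d d′ d>0 d′>0 h = ℚ.*-cancelʳ-≤-pos (d ℚ.* d′) {{ℚ.positive (*-pos d>0 d′>0)}} (subst₂ ℚ._≤_
  (trans (cong (ℚ._* d′) (sym (÷⁺-* x d d>0))) (ℚ.*-assoc (x ÷⁺ d ∵ d>0) d d′))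
  (trans (cong (ℚ._* d) (sym (÷⁺-* x′ d′ d′>0)))
    (solve 3 (λ u a b → u :* b :* a := u :* (a :* b)) refl (x′ ÷⁺ d′ ∵ d′>0) d d′))
  h)

-- Each summand grows with `q`: after cross-multiplication the two sides differ by
-- `(s + t) * (q′ - q)`, which is nonnegative.
riemann-mono : ∀ m q q′ q>0 q′>0 → q ℚ.≤ q′ → riemann m q q>0 ℚ.≤ riemann m q′ q′>0
riemann-mono m q q′ q>0 q′>0 q≤q′ = ∑-mono-< (suc m) λ j _ →
  ÷⁺-mono (q ℚ.- 1ℚ) (q′ ℚ.- 1ℚ) _ _ (den>0 m j q>0) (den>0 m j q′>0) (subst ((q ℚ.- 1ℚ) ℚ.* den (suc m) j q′ ℚ.≤_)
    (solve 4 (λ q q′ s t → (q :- con 1ℚ) :* (s :+ t :* q′) :+ (s :+ t) :* (q′ :- q) := (q′ :- con 1ℚ) :* (s :+ t :* q))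
      refl q q′ (ι (suc m ℕ.∸ j)) (ι j))
    (p≤p+q _ (*-mono-≤₀ (ℚ.≤-refl {0ℚ}) (0≤q′-q) (ℚ.+-mono-≤ (0≤ι (suc m ℕ.∸ j)) (0≤ι j)) 0≤q′-q)))
  where
  0≤q′-q : 0ℚ ℚ.≤ q′ ℚ.- q
  0≤q′-q = subst (ℚ._≤ q′ ℚ.- q) (ℚ.+-inverseʳ q) (ℚ.+-monoˡ-≤ (ℚ.- q) q≤q′)

-- With M = `suc m`, the denominators at q = 2 are M + j ≤ 2M, so each of the M summands is at least
-- 1/(2M). This yields log 2 ≥ ½.
½≤riemann₂ : ∀ m 2>0 → ½ ℚ.≤ riemann m (ι 2) 2>0
½≤riemann₂ m 2>0 = subst (ℚ._≤ riemann m (ι 2) 2>0)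
  (trans (∑-const (suc m) (½ ÷⁺ ι (suc m) ∵ 0<ι m)) (trans (ℚ.*-comm (ι (suc m)) _) (÷⁺-* ½ _ (0<ι m))))
  (∑-mono-< (suc m) λ j j<m → ÷⁺-mono ½ 1ℚ _ _ (0<ι m) (den>0 m j 2>0) (bound j j<m))
  where
  bound : ∀ j → j ℕ.< suc m → ½ ℚ.* den (suc m) j (ι 2) ℚ.≤ 1ℚ ℚ.* ι (suc m)
  bound j j<m = subst (½ ℚ.* den (suc m) j (ι 2) ℚ.≤_)
    (trans (solve 2 (λ s t → con ½ :* (s :+ t :* con (ι 2)) :+ con ½ :* s := con 1ℚ :* (s :+ t)) refl (ι (suc m ℕ.∸ j)) (ι j))
      (cong (1ℚ ℚ.*_) (trans (sym (ι-+ (suc m ℕ.∸ j) j)) (cong ι (ℕ.m∸n+n≡m (ℕ.<⇒≤ j<m))))))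
    (p≤p+q _ (*-mono-≤₀ (ℚ.≤-refl {0ℚ}) (0≤ι (suc m ℕ.∸ j)) (ℚ.nonNegative⁻¹ ½) (0≤ι (suc m ℕ.∸ j))))

riemann₁ : ∀ m 1>0 → riemann m (ι 1) 1>0 ≡ 0ℚ
riemann₁ m 1>0 = trans (∑-cong (suc m) λ j → ÷⁺-unique (den>0 m j 1>0) (ℚ.*-zeroˡ (den (suc m) j (ι 1))))
  (trans (∑-const (suc m) 0ℚ) (ℚ.*-zeroʳ (ι (suc m))))

recip : ℕ → ℚ
recip i = 1ℚ ÷⁺ ι (suc i) ∵ 0<ι i

-- With N′ = suc N this is Σ 1/i over N′ ≤ i < (1 + h) N′, the left Riemann sum of
-- ∫₁^{1+h} dt/t with step 1/N′.
harmonic : ℕ → ℕ → ℚ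
harmonic N h = ∑ (h ℕ.* suc N) λ j → recip (N ℕ.+ j)

-- With N′ = `suc N`, k = `suc h` and M = kN′ pieces, the step is 1/N′ and the denominator is M + jk
-- = k(N′ + j). The numerator k cancels.
riemann-harmonic : ∀ h N q>0 → riemann (N ℕ.+ h ℕ.* suc N) (ι (suc (suc h))) q>0 ≡ harmonic N (suc h)
riemann-harmonic h N q>0 = ∑-cong-< M λ j j<M →
  ÷⁺-unique (den>0 (N ℕ.+ h ℕ.* suc N) j q>0) (begin
    recip (N ℕ.+ j) ℚ.* den M j (ι (suc k))
      ≡⟨ cong (λ q → recip (N ℕ.+ j) ℚ.* (ι (M ℕ.∸ j) ℚ.+ ι j ℚ.* q)) (ι-suc k) ⟩
    recip (N ℕ.+ j) ℚ.* (ι (M ℕ.∸ j) ℚ.+ ι j ℚ.* (1ℚ ℚ.+ ι k))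
      ≡⟨ cong (recip (N ℕ.+ j) ℚ.*_) (solve 3 (λ s t k → s :+ t :* (con 1ℚ :+ k) := (s :+ t) :+ t :* k) refl (ι (M ℕ.∸ j)) (ι j) (ι k)) ⟩
    recip (N ℕ.+ j) ℚ.* ((ι (M ℕ.∸ j) ℚ.+ ι j) ℚ.+ ι j ℚ.* ι k)
      ≡⟨ cong (λ q → recip (N ℕ.+ j) ℚ.* (q ℚ.+ ι j ℚ.* ι k))
           (trans (sym (ι-+ (M ℕ.∸ j) j)) (trans (cong ι (ℕ.m∸n+n≡m (ℕ.<⇒≤ j<M))) (ι-* k (suc N)))) ⟩
    recip (N ℕ.+ j) ℚ.* (ι k ℚ.* ι (suc N) ℚ.+ ι j ℚ.* ι k)
      ≡⟨ solve 4 (λ r k n j → r :* (k :* n :+ j :* k) := k :* (r :* (n :+ j))) refl (recip (N ℕ.+ j)) (ι k) (ι (suc N)) (ι j) ⟩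
    ι k ℚ.* (recip (N ℕ.+ j) ℚ.* (ι (suc N) ℚ.+ ι j))
      ≡⟨ cong (λ q → ι k ℚ.* (recip (N ℕ.+ j) ℚ.* q)) (sym (ι-+ (suc N) j)) ⟩
    ι k ℚ.* (recip (N ℕ.+ j) ℚ.* ι (suc (N ℕ.+ j)))
      ≡⟨ cong (ι k ℚ.*_) (÷⁺-* 1ℚ (ι (suc (N ℕ.+ j))) (0<ι (N ℕ.+ j))) ⟩
    ι k ℚ.* 1ℚ
      ≡⟨ solve 1 (λ k → k :* con 1ℚ := (con 1ℚ :+ k) :- con 1ℚ) refl (ι k) ⟩
    (1ℚ ℚ.+ ι k) ℚ.- 1ℚ
      ≡⟨ cong (ℚ._- 1ℚ) (sym (ι-suc k)) ⟩
    ι (suc k) ℚ.- 1ℚ ∎)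
  where
  open ≡-Reasoning
  k = suc h
  M = k ℕ.* suc N

-- The index `g + h * suc g` is (1 + h)(1 + g) - 1. With N′ = `suc N`, the range of i is cut at (1 +
-- g)N′, where a harmonic sum with the finer step 1/((1 + g)N′) begins.
harmonic-* : ∀ N g h → harmonic N (g ℕ.+ h ℕ.* suc g) ≡ harmonic N g ℚ.+ harmonic (N ℕ.+ g ℕ.* suc N) h
harmonic-* N g h = trans (cong (λ k → ∑ k λ j → recip (N ℕ.+ j)) (split g h N))
  (trans (∑-+ (g ℕ.* suc N) (h ℕ.* suc (N ℕ.+ g ℕ.* suc N)) _)
    (cong (harmonic N g ℚ.+_) (∑-cong (h ℕ.* suc (N ℕ.+ g ℕ.* suc N)) λ j → cong recip (sym (ℕ.+-assoc N (g ℕ.* suc N) j)))))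
  where
  split : ∀ g h N → (g ℕ.+ h ℕ.* suc g) ℕ.* suc N ≡ g ℕ.* suc N ℕ.+ h ℕ.* suc (N ℕ.+ g ℕ.* suc N)
  split = solve-∀

-- The logarithm of a natural number

0<ι-nonZero : ∀ a .{{_ : NonZero a}} → 0ℚ ℚ.< ι a
0<ι-nonZero (suc a) = 0<ι a

positive : ∀ h → 0ℝ < fromℕ (suc h)
positive h = mk< 1ℚ (ℚ.positive⁻¹ 1ℚ) 0 λ _ _ → subst (ℚ._≤ ι (suc h)) (sym (ℚ.+-identityˡ 1ℚ)) (ι-mono (s≤s (z≤n {h})))

-- The positivity proof reaches the division only as an irrelevant argument, so any `q>0` gives the
-- same Riemann sum.
seq-log : ∀ x (x>0 : 0ℝ < x) k (q>0 : 0ℚ ℚ.< seq x (_<_.from x>0 ℕ.+ k)) →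
  seq (log x x>0) k ≡ riemann k (seq x (_<_.from x>0 ℕ.+ k)) q>0
seq-log x (mk< _ _ _ _) k q>0 = refl

-- Opaque, as comparing two logarithms by unfolding them to rational sums is
-- infeasible. The junk value is ln 0 = 0.
opaque
  ln : ℕ → ℝ
  ln zero    = 0ℝ
  ln (suc h) = log (fromℕ (suc h)) (positive h)

  ln≡log : ∀ h → ln (suc h) ≡ log (fromℕ (suc h)) (positive h)
  ln≡log h = refl

  seq-ln : ∀ a .{{_ : NonZero a}} k → seq (ln a) k ≡ riemann k (ι a) (0<ι-nonZero a)
  seq-ln (suc h) k = seq-log (fromℕ (suc h)) (positive h) k (0<ι h)

-- For a number h + 2, the harmonic sum with parameter `N` is itself the term of the sequence at
-- `N + h * suc N`, which is at least `N`, so the Cauchy property applies. For the number 1 both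
-- quantities vanish.
ln≈harmonic : ∀ h ε → 0ℚ ℚ.< ε → ∃[ K ] ∀ k N → K ℕ.≤ k → K ℕ.≤ N → ∣ seq (ln (suc h)) k ℚ.- harmonic N h ∣ ℚ.≤ ε
ln≈harmonic zero    ε ε>0 = 0 , λ k N _ _ → subst (λ p → ∣ p ℚ.- 0ℚ ∣ ℚ.≤ ε) (sym (trans (seq-ln 1 k) (riemann₁ k (0<ι-nonZero 1)))) (ℚ.<⇒≤ ε>0)
ln≈harmonic (suc h) ε ε>0 = let K , near = cauchy (ln (suc (suc h))) ε ε>0 in K , λ k N k≥ N≥ →
  subst (λ p → ∣ seq (ln (suc (suc h))) k ℚ.- p ∣ ℚ.≤ ε) (trans (seq-ln (suc (suc h)) _) (riemann-harmonic h N (0<ι (suc h))))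
    (near k (N ℕ.+ h ℕ.* suc N) k≥ (ℕ.≤-trans N≥ (ℕ.m≤m+n N _)))

-- Order and equality of reals

≤-pointwise : ∀ {x y} → (∀ k → seq x k ℚ.≤ seq y k) → x ≤ y
≤-pointwise h .eventually≤ ε ε>0 = 0 , λ k _ → ℚ.≤-trans (h k) (p≤p+q _ (ℚ.<⇒≤ ε>0))

infix 4 _≈_

record _≈_ (x y : ℝ) : Set where
  field
    close : ∀ ε → 0ℚ ℚ.< ε → ∃[ K ] ∀ k → K ℕ.≤ k → ∣ seq x k ℚ.- seq y k ∣ ℚ.≤ ε

open _≈_

≈⇒≤ : ∀ {x y} → x ≈ y → x ≤ y
≈⇒≤ {x} {y} x≈y .eventually≤ ε ε>0 = let K , near = close x≈y ε ε>0 in K , λ k k≥ →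
  near⇒≤ (seq x k) (seq y k) (near k k≥)

≈-sym : ∀ {x y} → x ≈ y → y ≈ x
≈-sym {x} {y} x≈y .close ε ε>0 = let K , near = close x≈y ε ε>0 in K , λ k k≥ →
  subst (ℚ._≤ ε) (∣p-q∣-sym (seq x k) (seq y k)) (near k k≥)

+-mono-≤ : ∀ {x y u v} → x ≤ y → u ≤ v → x + u ≤ y + v
+-mono-≤ {x} {y} {u} {v} (mk≤ p) (mk≤ q) .eventually≤ ε ε>0 =
  let K , hK = p (½ ℚ.* ε) (0<½* ε>0)
      L , hL = q (½ ℚ.* ε) (0<½* ε>0)
  in K ⊔ L , λ k k≥ → subst (seq x k ℚ.+ seq u k ℚ.≤_)
       (solve 3 (λ y v e → (y :+ con ½ :* e) :+ (v :+ con ½ :* e) := (y :+ v) :+ e) refl (seq y k) (seq v k) ε)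
       (ℚ.+-mono-≤ (hK k (ℕ.m⊔n≤o⇒m≤o K L k≥)) (hL k (ℕ.m⊔n≤o⇒n≤o K L k≥)))

·-monoʳ-≤ : ∀ n {x y} → x ≤ y → n · x ≤ n · y
·-monoʳ-≤ zero    x≤y = ≤-refl 0ℝ
·-monoʳ-≤ (suc n) x≤y = +-mono-≤ x≤y (·-monoʳ-≤ n x≤y)

seq-· : ∀ n x k → seq (n · x) k ≡ ι n ℚ.* seq x k
seq-· zero    x k = sym (ℚ.*-zeroˡ (seq x k))
seq-· (suc n) x k = trans (cong (seq x k ℚ.+_) (seq-· n x k))
  (trans (solve 2 (λ n x → x :+ n :* x := (con 1ℚ :+ n) :* x) refl (ι n) (seq x k)) (cong (ℚ._* seq x k) (sym (ι-suc n))))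

-- Monotonicity and functional equation of the logarithm

ln-mono-≤ : ∀ {a b} .{{_ : NonZero a}} .{{_ : NonZero b}} → a ℕ.≤ b → ln a ≤ ln b
ln-mono-≤ {a} {b} a≤b = ≤-pointwise λ k → subst₂ ℚ._≤_ (sym (seq-ln a k)) (sym (seq-ln b k)) (riemann-mono k (ι a) (ι b) (0<ι-nonZero a) (0<ι-nonZero b) (ι-mono a≤b))

-- `harmonic-*` is exact at every mesh, so only the three approximations by harmonic sums cost
-- anything: ε/2 for the product and ε/4 for each factor. The mesh parameter is `K` for the product
-- and for `suc g`, and `K + g * suc K` for `suc h`.
ln-* : ∀ h g → ln (suc (g ℕ.+ h ℕ.* suc g)) ≈ ln (suc h) + ln (suc g)
ln-* h g .close ε ε>0 =
  let K₁ , near₁ = ln≈harmonic (g ℕ.+ h ℕ.* suc g) η η>0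
      K₂ , near₂ = ln≈harmonic h θ θ>0
      K₃ , near₃ = ln≈harmonic g θ θ>0
      K = K₁ ⊔ (K₂ ⊔ K₃)
      K₁≤K = ℕ.m≤m⊔n K₁ (K₂ ⊔ K₃)
      K₂≤K = ℕ.≤-trans (ℕ.m≤m⊔n K₂ K₃) (ℕ.m≤n⊔m K₁ (K₂ ⊔ K₃))
      K₃≤K = ℕ.≤-trans (ℕ.m≤n⊔m K₂ K₃) (ℕ.m≤n⊔m K₁ (K₂ ⊔ K₃))
  in K , λ k k≥ → combined (seq (ln (suc (g ℕ.+ h ℕ.* suc g))) k) (seq (ln (suc h)) k) (seq (ln (suc g)) k)
       (harmonic-* K g h)
       (near₁ k K (ℕ.≤-trans K₁≤K k≥) K₁≤K)
       (near₂ k (K ℕ.+ g ℕ.* suc K) (ℕ.≤-trans K₂≤K k≥) (ℕ.≤-trans K₂≤K (ℕ.m≤m+n K _)))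
       (near₃ k K (ℕ.≤-trans K₃≤K k≥) K₃≤K)
  where
  η θ : ℚ
  η = ½ ℚ.* ε
  θ = ½ ℚ.* η
  η>0 : 0ℚ ℚ.< η
  η>0 = 0<½* ε>0
  θ>0 : 0ℚ ℚ.< θ
  θ>0 = 0<½* η>0
  combined : ∀ x y z {u v w} → u ≡ w ℚ.+ v → ∣ x ℚ.- u ∣ ℚ.≤ η → ∣ y ℚ.- v ∣ ℚ.≤ θ → ∣ z ℚ.- w ∣ ℚ.≤ θ →
    ∣ x ℚ.- (y ℚ.+ z) ∣ ℚ.≤ ε
  combined x y z {v = v} {w} refl x-u y-v z-w = begin
    ∣ x ℚ.- (y ℚ.+ z) ∣                             ≤⟨ triangle x (w ℚ.+ v) (y ℚ.+ z) ⟩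
    ∣ x ℚ.- (w ℚ.+ v) ∣ ℚ.+ ∣ (w ℚ.+ v) ℚ.- (y ℚ.+ z) ∣
      ≡⟨ cong (λ p → ∣ x ℚ.- (w ℚ.+ v) ∣ ℚ.+ ∣ p ∣) (solve 4 (λ v w y z → (w :+ v) :- (y :+ z) := (v :- y) :+ (w :- z)) refl v w y z) ⟩
    ∣ x ℚ.- (w ℚ.+ v) ∣ ℚ.+ ∣ (v ℚ.- y) ℚ.+ (w ℚ.- z) ∣
      ≤⟨ ℚ.+-mono-≤ x-u (ℚ.≤-trans (ℚ.∣p+q∣≤∣p∣+∣q∣ (v ℚ.- y) (w ℚ.- z))
           (ℚ.+-mono-≤ (subst (ℚ._≤ θ) (∣p-q∣-sym y v) y-v) (subst (ℚ._≤ θ) (∣p-q∣-sym z w) z-w))) ⟩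
    η ℚ.+ (θ ℚ.+ θ)                                 ≡⟨ cong (η ℚ.+_) (halves η) ⟩
    η ℚ.+ η                                         ≡⟨ halves ε ⟩
    ε ∎
    where open ℚ.≤-Reasoning

ln-*-≤ : ∀ a b .{{_ : NonZero a}} .{{_ : NonZero b}} → ln (a ℕ.* b) ≤ ln a + ln b
ln-*-≤ (suc h) (suc g) = ≈⇒≤ (ln-* h g)

ln-*-≥ : ∀ a b .{{_ : NonZero a}} .{{_ : NonZero b}} → ln a + ln b ≤ ln (a ℕ.* b)
ln-*-≥ (suc h) (suc g) = ≈⇒≤ (≈-sym (ln-* h g))

ln-^-≤ : ∀ a n .{{_ : NonZero a}} → ln (a ^ n) ≤ n · ln a
ln-^-≤ a zero    = ≤-pointwise λ k → ℚ.≤-reflexive (trans (seq-ln 1 k) (riemann₁ k (0<ι-nonZero 1)))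
ln-^-≤ a (suc n) {{a≢0}} = ≤-trans (ln-*-≤ a (a ^ n) {{a≢0}} {{ℕ.m^n≢0 a n}}) (+-mono-≤ (≤-refl (ln a)) (ln-^-≤ a n))

ln-^-≥ : ∀ a n .{{_ : NonZero a}} → n · ln a ≤ ln (a ^ n)
ln-^-≥ a zero    = ≤-pointwise λ k → ℚ.≤-reflexive (sym (trans (seq-ln 1 k) (riemann₁ k (0<ι-nonZero 1))))
ln-^-≥ a (suc n) {{a≢0}} = ≤-trans (+-mono-≤ (≤-refl (ln a)) (ln-^-≥ a n)) (ln-*-≥ a (a ^ n) {{a≢0}} {{ℕ.m^n≢0 a n}})

½≤ln : ∀ a .{{_ : NonZero a}} → 2 ℕ.≤ a → ∀ k → ½ ℚ.≤ seq (ln a) k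
½≤ln a 2≤a k = subst (½ ℚ.≤_) (sym (seq-ln a k))
  (ℚ.≤-trans (½≤riemann₂ k (0<ι-nonZero 2)) (riemann-mono k (ι 2) (ι a) (0<ι-nonZero 2) (0<ι-nonZero a) (ι-mono 2≤a)))

-- Lower bounds for log n and log log n

-- Rests on log 2 ≥ ½. The lost constant factor sits inside the outer logarithm of log log n and
-- costs only O(n) in the end.
2^p≤n⇒p/2≤ln : ∀ {p n} .{{_ : NonZero n}} → 2 ^ p ℕ.≤ n → p · fromℚ ½ ≤ ln n
2^p≤n⇒p/2≤ln {p} {n} {{n≢0}} 2^p≤n = ≤-trans (·-monoʳ-≤ p (≤-pointwise (½≤ln 2 ℕ.≤-refl)))
  (≤-trans (ln-^-≥ 2 p) (ln-mono-≤ {{ℕ.m^n≢0 2 p}} {{n≢0}} 2^p≤n))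

-- Here p/2 ≥ t + 1, and the spare 1 absorbs the tolerance ε = 1 in the definition of `≤`, leaving a
-- bound on the approximations themselves.
eventually≥ : ∀ {x} p t → 2 ℕ.* suc t ℕ.≤ p → p · fromℚ ½ ≤ x → ∃[ K ] ∀ k → K ℕ.≤ k → ι t ℚ.≤ seq x k
eventually≥ {x} p t 2t+2≤p p/2≤x = let K , h = eventually≤ p/2≤x 1ℚ (ℚ.positive⁻¹ 1ℚ) in K , λ k k≥ →
  subst₂ ℚ._≤_ (cancel (ι t)) (cancel (seq x k)) (ℚ.+-monoˡ-≤ (ℚ.- 1ℚ) (begin
    ι t ℚ.+ 1ℚ                 ≡⟨ trans (ℚ.+-comm (ι t) 1ℚ) (sym (ι-suc t)) ⟩
    ι (suc t)                  ≡⟨ solve 1 (λ t → t := (con (ι 2) :* t) :* con ½) refl (ι (suc t)) ⟩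
    ι 2 ℚ.* ι (suc t) ℚ.* ½    ≡⟨ cong (ℚ._* ½) (sym (ι-* 2 (suc t))) ⟩
    ι (2 ℕ.* suc t) ℚ.* ½      ≤⟨ ℚ.*-monoʳ-≤-nonNeg ½ (ι-mono 2t+2≤p) ⟩
    ι p ℚ.* ½                  ≡⟨ sym (seq-· p (fromℚ ½) k) ⟩
    seq (p · fromℚ ½) k        ≤⟨ h k k≥ ⟩
    seq x k ℚ.+ 1ℚ             ∎))
  where
  open ℚ.≤-Reasoning
  cancel : ∀ q → (q ℚ.+ 1ℚ) ℚ.+ ℚ.- 1ℚ ≡ q
  cancel = solve 1 (λ q → (q :+ con 1ℚ) :- con 1ℚ := q) refl

-- The positivity witness is built to start at `K`, so the sequence of the logarithm uses only
-- approximations of `x` above `suc t`. Monotonicity of Riemann sums then applies at every index.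
ln≤log : ∀ {x} t K → (∀ k → K ℕ.≤ k → ι (suc t) ℚ.≤ seq x k) → Σ[ x>0 ∈ 0ℝ < x ] ln (suc t) ≤ log x x>0
ln≤log {x} t K t≤x = x>0 , ≤-pointwise λ k → subst₂ ℚ._≤_
  (sym (seq-ln (suc t) k)) (sym (seq-log x x>0 k (q>0 k)))
  (riemann-mono k (ι (suc t)) (seq x (K ℕ.+ k)) (0<ι-nonZero (suc t)) (q>0 k) (t≤x (K ℕ.+ k) (ℕ.m≤m+n K k)))
  where
  x>0 : 0ℝ < x
  x>0 = mk< (ι (suc t)) (0<ι t) K λ k k≥ → subst (ℚ._≤ seq x k) (sym (ℚ.+-identityˡ (ι (suc t)))) (t≤x k k≥)
  q>0 : ∀ k → 0ℚ ℚ.< seq x (K ℕ.+ k)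
  q>0 k = ℚ.<-≤-trans (0<ι t) (t≤x (K ℕ.+ k) (ℕ.m≤m+n K k))

-- Taking logarithms of the bound

-- Carried out on the rational approximations. The term 2n · c turns into `n · (c + c)`, which makes
-- `c + c` the constant of the final bound.
rearrange : ∀ n {x y z c} → n · x ≤ z + (2 ℕ.* n) · (c + y) → n · x - (2 ℕ.* n) · y - n · (c + c) ≤ z
rearrange n {x} {y} {z} {c} (mk≤ h) .eventually≤ ε ε>0 = let K , hK = h ε ε>0 in K , λ k k≥ →
  subst₂ (λ p q → seq (n · x) k ℚ.- p ℚ.- q ℚ.≤ seq z k ℚ.+ ε) (sym (double y k)) (sym (seq-· n (c + c) k))
    (move (seq (n · x) k) (seq z k) (ι n) (seq c k) (seq y k)
      (subst (λ p → seq (n · x) k ℚ.≤ seq z k ℚ.+ p ℚ.+ ε) (double (c + y) k) (hK k k≥)))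
  where
  double : ∀ w k → seq ((2 ℕ.* n) · w) k ≡ (ι n ℚ.+ ι n) ℚ.* seq w k
  double w k = trans (seq-· (2 ℕ.* n) w k) (cong (ℚ._* seq w k)
    (trans (ι-+ n (n ℕ.+ 0)) (cong (λ m → ι n ℚ.+ ι m) (ℕ.+-identityʳ n))))
  move : ∀ x z n c y → x ℚ.≤ z ℚ.+ (n ℚ.+ n) ℚ.* (c ℚ.+ y) ℚ.+ ε →
    x ℚ.- (n ℚ.+ n) ℚ.* y ℚ.- n ℚ.* (c ℚ.+ c) ℚ.≤ z ℚ.+ ε
  move x z n c y h = subst (x ℚ.- (n ℚ.+ n) ℚ.* y ℚ.- n ℚ.* (c ℚ.+ c) ℚ.≤_)
    (solve 5 (λ z n c y e → z :+ (n :+ n) :* (c :+ y) :+ e :- (n :+ n) :* y :- n :* (c :+ c) := z :+ e) refl z n c y ε)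
    (ℚ.+-monoˡ-≤ (ℚ.- (n ℚ.* (c ℚ.+ c))) (ℚ.+-monoˡ-≤ (ℚ.- ((n ℚ.+ n) ℚ.* y)) h))

ln-^-*-≤ : ∀ m b t {y} .{{_ : NonZero b}} .{{_ : NonZero t}} → ln t ≤ y → ln ((b ℕ.* t) ^ m) ≤ m · (ln b + y)
ln-^-*-≤ m b t t≤y = ≤-trans (ln-^-≤ (b ℕ.* t) m {{ℕ.m*n≢0 b t}})
  (·-monoʳ-≤ m (≤-trans (ln-*-≤ b t) (+-mono-≤ (≤-refl (ln b)) t≤y)))

ln-^-≤-* : ∀ n i x .{{_ : NonZero n}} .{{_ : NonZero i}} .{{_ : NonZero x}} →
  n ^ n ℕ.≤ i ℕ.* x → n · ln n ≤ ln i + ln x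
ln-^-≤-* n i x bound = ≤-trans (ln-^-≥ n n)
  (≤-trans (ln-mono-≤ {{ℕ.m^n≢0 n n}} {{ℕ.m*n≢0 i x}} bound) (ln-*-≤ i x))

ln-bound : ∀ n i b t {y} .{{n≢0 : NonZero n}} .{{i≢0 : NonZero i}} .{{_ : NonZero b}} .{{_ : NonZero t}} →
  n ^ n ℕ.≤ i ℕ.* (b ℕ.* t) ^ (2 ℕ.* n) → ln t ≤ y →
  n · ln n - (2 ℕ.* n) · y - n · (ln b + ln b) ≤ ln i
ln-bound n i b t {y} {{n≢0}} {{i≢0}} bound t≤y = rearrange n {ln n} {y} {ln i} {ln b} (≤-trans
  (ln-^-≤-* n i ((b ℕ.* t) ^ (2 ℕ.* n)) {{n≢0}} {{i≢0}} {{ℕ.m^n≢0 (b ℕ.* t) (2 ℕ.* n) {{ℕ.m*n≢0 b t}}}} bound)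
  (+-mono-≤ (≤-refl (ln i)) (ln-^-*-≤ (2 ℕ.* n) b t t≤y)))

ln-log : ∀ n .{{_ : NonZero n}} → Σ[ n>0 ∈ 0ℝ < fromℕ n ] ln n ≡ log (fromℕ n) n>0
ln-log (suc n) = positive n , ln≡log n

ln≤log∘ln : ∀ n t p .{{_ : NonZero n}} → 2 ^ p ℕ.≤ n → 2 ℕ.* suc (suc t) ℕ.≤ p →
  Σ[ ln>0 ∈ 0ℝ < ln n ] ln (suc t) ≤ log (ln n) ln>0
ln≤log∘ln n t p 2^p≤n 2t+4≤p =
  let K , large = eventually≥ {ln n} p (suc t) 2t+4≤p (2^p≤n⇒p/2≤ln {p} {n} 2^p≤n) in ln≤log {ln n} t K large

ln-lower-bound : ∀ b n i t p .{{_ : NonZero b}} .{{_ : NonZero n}} .{{_ : NonZero i}} →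
  n ^ n ℕ.≤ i ℕ.* (b ℕ.* suc t) ^ (2 ℕ.* n) → 2 ^ p ℕ.≤ n → 2 ℕ.* suc (suc t) ℕ.≤ p →
  Σ[ ln>0 ∈ 0ℝ < ln n ] n · ln n - (2 ℕ.* n) · log (ln n) ln>0 - n · (ln b + ln b) ≤ ln i
ln-lower-bound b n i t p bound 2^p≤n 2t+4≤p =
  let ln>0 , ln-t≤ = ln≤log∘ln n t p 2^p≤n 2t+4≤p in ln>0 , ln-bound n i b (suc t) {log (ln n) ln>0} bound ln-t≤

ln⇒log : ∀ n i c .{{_ : NonZero n}} .{{_ : NonZero i}} →
  Σ[ ln>0 ∈ 0ℝ < ln n ] n · ln n - (2 ℕ.* n) · log (ln n) ln>0 - n · c ≤ ln i →
  Σ[ n>0 ∈ 0ℝ < fromℕ n ]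
  Σ[ log-n>0 ∈ 0ℝ < log (fromℕ n) n>0 ]
  Σ[ i>0 ∈ 0ℝ < fromℕ i ]
    n · log (fromℕ n) n>0 - (2 ℕ.* n) · log (log (fromℕ n) n>0) log-n>0 - n · c ≤ log (fromℕ i) i>0
ln⇒log n i c (ln>0 , bound) =
  let n>0 , ln-n≡ = ln-log n
      i>0 , ln-i≡ = ln-log i
      log-n>0 , bound′ = transport ln-n≡ ln-i≡
  in n>0 , log-n>0 , i>0 , bound′
  where
  -- With `x` and `z` as variables, matching on `refl` replaces the opaque `ln` by `log` also inside
  -- the positivity proof that the outer logarithm depends on.
  transport : ∀ {x z} → ln n ≡ x → ln i ≡ z → Σ[ x>0 ∈ 0ℝ < x ] n · x - (2 ℕ.* n) · log x x>0 - n · c ≤ z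
  transport refl refl = ln>0 , bound

-- Choice of parameters and conclusion

-- For p ≈ log₂ n and ℓ = p + 1, the number t + 1 lies between ℓ/6 and p/2 - 1 ≤ log n.
scale : ∀ p → 4 ℕ.≤ p → ∃[ t ] 2 ℕ.* suc (suc t) ℕ.≤ p × suc p ℕ.≤ 6 ℕ.* suc t
scale (suc (suc (suc (suc p)))) (s≤s (s≤s (s≤s (s≤s z≤n)))) = t , lower , upper
  where
  open ℕ.≤-Reasoning
  t = p ℕ./ 2
  r = p ℕ.% 2
  lower : 2 ℕ.* suc (suc t) ℕ.≤ 4 ℕ.+ p
  lower = begin
    2 ℕ.* suc (suc t)  ≡⟨ eq t ⟩
    4 ℕ.+ t ℕ.* 2      ≤⟨ ℕ.+-monoʳ-≤ 4 (ℕ.m/n*n≤m p 2) ⟩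
    4 ℕ.+ p            ∎
    where
    eq : ∀ t → 2 ℕ.* suc (suc t) ≡ 4 ℕ.+ t ℕ.* 2
    eq = solve-∀
  upper : 5 ℕ.+ p ℕ.≤ 6 ℕ.* suc t
  upper = begin
    5 ℕ.+ p                  ≡⟨ cong (5 ℕ.+_) (ℕ.m≡m%n+[m/n]*n p 2) ⟩
    5 ℕ.+ (r ℕ.+ t ℕ.* 2)    ≤⟨ ℕ.+-monoʳ-≤ 5 (ℕ.+-mono-≤ (ℕ.s≤s⁻¹ (ℕ.m%n<n p 2)) (ℕ.*-monoʳ-≤ t (s≤s (s≤s (z≤n {4}))))) ⟩
    5 ℕ.+ (1 ℕ.+ t ℕ.* 6)    ≡⟨ eq t ⟩
    6 ℕ.* suc t              ∎
    where
    eq : ∀ t → 5 ℕ.+ (1 ℕ.+ t ℕ.* 6) ≡ 6 ℕ.* suc t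
    eq = solve-∀

I-bound-scaled : ∀ n x p → 16 ℕ.≤ n → 4 ℕ.≤ p → 2 ^ p ℕ.≤ n → n ℕ.< 2 ^ suc p → 8 ℕ.* suc p ℕ.≤ x →
  n ^ n ℕ.≤ I n ℕ.* x ^ (2 ℕ.* n)
I-bound-scaled n x p 16≤n 4≤p 2^p≤n n<2^1+p 8ℓ≤x = ℕ.≤-trans
  -- The choice is ℓ = p + 1; ℓ ≤ n follows from p < 2^p ≤ n.
  (I-bound n (suc p) (s≤s (ℕ.≤-trans (s≤s z≤n) 4≤p)) (ℕ.≤-trans (n<2^n p) 2^p≤n) (ℕ.<⇒≤ n<2^1+p))
  (ℕ.*-monoʳ-≤ (I n) (ℕ.^-monoˡ-≤ (2 ℕ.* n) 8ℓ≤x))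

0<ln+ln : ∀ a .{{_ : NonZero a}} → 2 ℕ.≤ a → 0ℝ < ln a + ln a
0<ln+ln a 2≤a = mk< ½ (ℚ.positive⁻¹ ½) 0 λ k _ → subst (ℚ._≤ seq (ln a) k ℚ.+ seq (ln a) k)
  (ℚ.+-comm ½ 0ℚ) (ℚ.+-mono-≤ (½≤ln a 2≤a k) (ℚ.≤-trans (ℚ.nonNegative⁻¹ ½) (½≤ln a 2≤a k)))

-- Supplies the positivity of `I n` that its logarithm requires: otherwise the right side would be
-- 0, while n^n > 0.
^≤*⇒nonZero : ∀ n i x .{{_ : NonZero n}} → n ^ n ℕ.≤ i ℕ.* x → NonZero i
^≤*⇒nonZero n zero    x bound = contradiction bound (ℕ.<⇒≱ (ℕ.m^n>0 n n))
^≤*⇒nonZero n (suc i) x bound = _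

theorem1 : ∃[ C ] 0ℝ < C × (∃[ N ] ∀ n → N ℕ.≤ n →
    Σ[ n>0 ∈ 0ℝ < fromℕ n ]
    Σ[ log-n>0 ∈ 0ℝ < log (fromℕ n) n>0 ]
    Σ[ I>0 ∈ 0ℝ < fromℕ (I n) ]
    n · log (fromℕ n) n>0 - (2 ℕ.* n) · log (log (fromℕ n) n>0) log-n>0 - n · C
    ≤ log (fromℕ (I n)) I>0)
-- 48 = 8 · 6, from the base 8ℓ and ℓ ≤ 6(t + 1); the exponent 2n doubles its logarithm. The
-- threshold 16 = 2^4 forces p ≥ 4, as `scale` demands.
theorem1 = ln 48 + ln 48 , 0<ln+ln 48 (s≤s (s≤s z≤n)) , 16 , λ n 16≤n →
  let p , 2^p≤n , n<2^1+p = binary-log n (ℕ.≤-trans (s≤s z≤n) 16≤n)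
      4≤p = ℕ.≮⇒≥ λ p<4 → ℕ.<⇒≱ n<2^1+p (ℕ.≤-trans (ℕ.^-monoʳ-≤ 2 p<4) 16≤n)
      t , 2t+4≤p , ℓ≤6t = scale p 4≤p
      bound = I-bound-scaled n (48 ℕ.* suc t) p 16≤n 4≤p 2^p≤n n<2^1+p
        (ℕ.≤-trans (ℕ.*-monoʳ-≤ 8 ℓ≤6t) (ℕ.≤-reflexive (sym (ℕ.*-assoc 8 6 (suc t)))))
      n≢0 = ℕ.>-nonZero (ℕ.≤-trans (s≤s z≤n) 16≤n)
      I≢0 = ^≤*⇒nonZero n (I n) ((48 ℕ.* suc t) ^ (2 ℕ.* n)) {{n≢0}} bound
  in ln⇒log n (I n) (ln 48 + ln 48) {{n≢0}} {{I≢0}} (ln-lower-bound 48 n (I n) t p {{_}} {{n≢0}} {{I≢0}} bound 2^p≤n 2t+4≤p)
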